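{- Let $(J,\mathcal{B},\pi)$ be a standard Borel probability space, and for a $\mathcal{B}$-partition $\mathcal{P}$ of $J$ let $$\psi(\mathcal{P})=\mathsf{E}\Big(\frac{1}{|\mathcal{P}_{\mathbf{u}}|}\Big),$$ where $\mathbf{u}$ is a random point of $J$ with distribution $\pi$, $\mathcal{P}_u$ is the class of $\mathcal{P}$ containing $u$, and $1/|\mathcal{P}_u|=0$ if $\mathcal{P}_u$ is infinite. Let $\mathcal{P}$, $\mathcal{Q}$ and $\mathcal{R}$ be $\mathcal{B}$-partitions of $J$ with the re-randomizing property such that $\mathcal{R}\le\mathcal{P}$ and $\mathcal{R}\le\mathcal{Q}$. Then $$\psi(\mathcal{R})+\psi(\mathcal{P}\lor\mathcal{Q})\ge\psi(\mathcal{P})+\psi(\mathcal{Q}).$$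
   Context: For a partition $\mathcal{P}$ of $J$ and $X\subseteq J$, let $\mathcal{P}(X)=\bigcup\{P\in\mathcal{P}: P\cap X\ne\emptyset\}$. A partition $\mathcal{P}$ is a $\mathcal{B}$-partition if $\mathcal{P}(A)\in\mathcal{B}$ whenever $A\in\mathcal{B}$. For partitions, $\mathcal{R}\le\mathcal{P}$ means that $\mathcal{R}$ refines $\mathcal{P}$ (every class of $\mathcal{R}$ is contained in a class of $\mathcal{P}$), and $\mathcal{P}\lor\mathcal{Q}$ is the join in the partition lattice, i.e. the finest partition coarser than both $\mathcal{P}$ and $\mathcal{Q}$. Re-randomizing: let $\mathbf{u}$ be a random point from $\pi$. If $\mathcal{P}_{\mathbf{u}}$ is finite, let $\mathbf{v}$ be a uniform random point of $\mathcal{P}_{\mathbf{u}}$; else let $\mathbf{v}=\mathbf{u}$. The $\mathcal{B}$-partition $\mathcal{P}$ has the re-randomizing property (with respect to $\pi$) if $\mathbf{v}$ has distribution $\pi$. Equivalently, if $\mu_x$ is the uniform distribution on $\mathcal{P}_x$ when $\mathcal{P}_x$ is finite and $\mu_x=\delta_x$ otherwise, then $\int_J\mu_x(A)\,d\pi(x)=\pi(A)$ for all $A\in\mathcal{B}$. -}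

module Defs where

open import Level using (Level; _⊔_; Lift; lift; 0ℓ) renaming (suc to lsuc)
open import Data.Fin.Base using (Fin; toℕ)
open import Data.Integer.Base using (+_)
open import Data.List.Base as List using (List)
open import Data.Maybe.Base using (Maybe; just)
open import Data.Nat.Base as ℕ using (ℕ; zero; suc)
open import Data.Product.Base using (Σ; ∃; ∃₂; _×_; _,_; proj₁; proj₂)
open import Data.Rational.Base as ℚ using (ℚ; 0ℚ; 1ℚ)
import Data.Rational.Properties as ℚ
open import Data.Sum.Base using (_⊎_; inj₁; inj₂; [_,_])
import Data.Unit.Polymorphic.Base as Unit
import Data.Empty.Polymorphic as Empty
import Data.Vec.Functional as Vector
open import Function.Base using (_∘_; _on_)
open import Function.Bundles using (_⇔_)
open import Function.Definitions using (Injective)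
open import Function.Metric.Structures using (IsGeneralMetric)
open import Relation.Binary.Core using (Rel)
open import Relation.Binary.Definitions using (Reflexive; Symmetric; Transitive)
open import Relation.Binary.Lattice.Definitions using (Supremum)
open import Relation.Binary.PropositionalEquality.Core using (_≡_; refl; sym; trans; cong; subst)
open import Relation.Binary.Structures using (IsEquivalence; IsPartialOrder)
import Relation.Binary.Construct.Closure.Equivalence as Eq
open import Relation.Binary.Construct.Closure.ReflexiveTransitive using (Star; ε; _◅_)
open import Relation.Binary.Construct.Closure.Symmetric using (SymClosure; fwd; bwd)
open import Relation.Binary.Construct.Union using () renaming (_∪_ to _∪ᵣ_)
open import Relation.Nullary.Negation.Core using (¬_)
open import Relation.Unary using (Pred; _⊆_; _≐_; _≬_; _∩_; ∁; ⋃; Empty)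

private
  variable
    a b i ℓ : Level

------------------------------------------------------------------------
-- Extended non-negative reals

infix  4 _<ʳ_ _≺_ _≤_ _≈_
infixl 6 _+_
infixl 7 _·_

-- An element x of [0,∞] is given by its open lower cut { q ∈ ℚ | q < x },
-- which contains every negative rational and is all of ℚ for x = ∞.  The
-- level is that of the propositions q < x; with excluded middle the choice of
-- level does not affect which reals there are.

record ℝ⁺∞ a : Set (lsuc a) where
  field
    below    : Pred ℚ a
    negative : ∀ {q} → q ℚ.< 0ℚ → below q
    downward : ∀ {p q} → p ℚ.< q → below q → below p
    rounded  : ∀ {q} → below q → ∃ λ r → q ℚ.< r × below r

open ℝ⁺∞

_<ʳ_ : ℚ → ℝ⁺∞ a → Set a
q <ʳ x = below x q

_≺_ : ℝ⁺∞ a → ℚ → Set a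
x ≺ q = ∃ λ r → r ℚ.< q × ¬ r <ʳ x

_≤_ : ℝ⁺∞ a → ℝ⁺∞ b → Set (a ⊔ b)
x ≤ y = ∀ {q} → q <ʳ x → q <ʳ y

_≈_ : ℝ⁺∞ a → ℝ⁺∞ b → Set (a ⊔ b)
x ≈ y = x ≤ y × y ≤ x

≤-isPartialOrder : IsPartialOrder (_≈_ {a} {a}) _≤_
≤-isPartialOrder = record
  { isPreorder = record
    { isEquivalence = record
      { refl  = (λ p → p) , (λ p → p)
      ; sym   = λ (f , g) → g , f
      ; trans = λ (f , g) (h , k) → (λ p → h (f p)) , (λ p → g (k p))
      }
    ; reflexive = λ (f , _) → f
    ; trans     = λ f g p → g (f p)
    }
  ; antisym = λ f g → f , g
  }

Finite : ℝ⁺∞ a → Set a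
Finite x = ∃ λ q → x ≺ q

0# : ℝ⁺∞ a
0# {a} = record
  { below    = λ q → Lift a (q ℚ.< 0ℚ)
  ; negative = lift
  ; downward = λ p<q (lift q<0) → lift (ℚ.<-trans p<q q<0)
  ; rounded  = λ (lift q<0) → let r , q<r , r<0 = ℚ.<-dense q<0 in
               r , q<r , lift r<0
  }

-- max(c, 0); only used for c ≥ 0.
fromℚ : ℚ → ℝ⁺∞ 0ℓ
fromℚ c = record
  { below    = λ q → q ℚ.< 0ℚ ⊎ q ℚ.< c
  ; negative = inj₁
  ; downward = λ p<q → [ inj₁ ∘ ℚ.<-trans p<q , inj₂ ∘ ℚ.<-trans p<q ]
  ; rounded  =
      [ (λ q<0 → let r , q<r , r<0 = ℚ.<-dense q<0 in r , q<r , inj₁ r<0)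
      , (λ q<c → let r , q<r , r<c = ℚ.<-dense q<c in r , q<r , inj₂ r<c) ]
  }

1# : ℝ⁺∞ 0ℓ
1# = fromℚ 1ℚ

-- The supremum of an arbitrary family in [0,∞]; the supremum of the empty
-- family is 0.
⨆ : (I : Set i) → (I → ℝ⁺∞ a) → ℝ⁺∞ (i ⊔ a)
⨆ I x = record
  { below    = λ q → q ℚ.< 0ℚ ⊎ ∃ λ j → q <ʳ x j
  ; negative = inj₁
  ; downward = λ p<q →
      [ inj₁ ∘ ℚ.<-trans p<q
      , (λ (j , q<x) → inj₂ (j , downward (x j) p<q q<x)) ]
  ; rounded  =
      [ (λ q<0 → let r , q<r , r<0 = ℚ.<-dense q<0 in r , q<r , inj₁ r<0)
      , (λ (j , q<x) → let r , q<r , r<x = rounded (x j) q<x in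
                       r , q<r , inj₂ (j , r<x)) ]
  }

private
  split : ∀ {p q} → p ℚ.+ (q ℚ.- p) ≡ q
  split {p} {q} =
    trans (cong (p ℚ.+_) (ℚ.+-comm q (ℚ.- p)))
    (trans (sym (ℚ.+-assoc p (ℚ.- p) q))
    (trans (cong (ℚ._+ q) (ℚ.+-inverseʳ p)) (ℚ.+-identityˡ q)))

  diff<0 : ∀ {p q} → q ℚ.< p → q ℚ.- p ℚ.< 0ℚ
  diff<0 {p} {q} q<p =
    subst (q ℚ.- p ℚ.<_) (ℚ.+-inverseʳ p) (ℚ.+-monoˡ-< (ℚ.- p) q<p)

_+_ : ℝ⁺∞ a → ℝ⁺∞ b → ℝ⁺∞ (a ⊔ b)
x + y = record
  { below    = λ q → ∃₂ λ r s → r <ʳ x × s <ʳ y × q ℚ.≤ r ℚ.+ s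
  ; negative = λ {q} q<0 →
      let r , q<r , r<0 = ℚ.<-dense q<0 in
      r , q ℚ.- r , negative x r<0 , negative y (diff<0 q<r)
        , ℚ.≤-reflexive (sym (split {r}))
  ; downward = λ p<q (r , s , r<x , s<y , q≤r+s) →
      r , s , r<x , s<y , ℚ.≤-trans (ℚ.<⇒≤ p<q) q≤r+s
  ; rounded  = λ (r , s , r<x , s<y , q≤r+s) →
      let t , r<t , t<x = rounded x r<x in
      t ℚ.+ s , ℚ.≤-<-trans q≤r+s (ℚ.+-monoˡ-< s r<t)
        , t , s , t<x , s<y , ℚ.≤-refl
  }

-- Multiplication by a rational c ≥ 0, with 0 · ∞ = 0.
_·_ : ℚ → ℝ⁺∞ a → ℝ⁺∞ a
c · x = record
  { below    = λ q → q ℚ.< 0ℚ ⊎ ∃ λ r → r <ʳ x × q ℚ.< c ℚ.* r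
  ; negative = inj₁
  ; downward = λ p<q →
      [ inj₁ ∘ ℚ.<-trans p<q
      , (λ (r , r<x , q<cr) → inj₂ (r , r<x , ℚ.<-trans p<q q<cr)) ]
  ; rounded  =
      [ (λ q<0 → let r , q<r , r<0 = ℚ.<-dense q<0 in r , q<r , inj₁ r<0)
      , (λ (r , r<x , q<cr) → let s , q<s , s<cr = ℚ.<-dense q<cr in
                              s , q<s , inj₂ (r , r<x , s<cr)) ]
  }

∑ : ∀ {n} → (Fin n → ℝ⁺∞ a) → ℝ⁺∞ a
∑ = Vector.foldr _+_ 0#

∑∞ : (ℕ → ℝ⁺∞ a) → ℝ⁺∞ a
∑∞ x = ⨆ ℕ λ n → ∑ {n = n} (x ∘ toℕ)

-- Indicator function.
𝟙 : ∀ {J : Set ℓ} → Pred J a → J → ℝ⁺∞ a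
𝟙 A x = ⨆ (A x) λ _ → 1#

------------------------------------------------------------------------
-- Standard Borel spaces

-- Subsets are predicates, equal when they have the same elements; hence a
-- σ-algebra is required to be closed under _≐_.

record MeasurableSpace ℓ : Set (lsuc (lsuc ℓ)) where
  field
    J          : Set ℓ
    ℬ          : Pred (Pred J ℓ) (lsuc ℓ)
    ℬ-resp     : ∀ {A B} → A ≐ B → ℬ A → ℬ B
    ℬ-full     : ℬ (λ _ → Unit.⊤)
    ℬ-∁        : ∀ {A} → ℬ A → ℬ (∁ A)
    ℬ-⋃        : ∀ {A : ℕ → Pred J ℓ} → (∀ n → ℬ (A n)) → ℬ (⋃ ℕ A)

-- The σ-algebra generated by a family of subsets.
data Generated {J : Set ℓ} (𝒢 : Pred (Pred J ℓ) ℓ) : Pred (Pred J ℓ) (lsuc ℓ) where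
  generator  : ∀ {A} → 𝒢 A → Generated 𝒢 A
  respects   : ∀ {A B} → A ≐ B → Generated 𝒢 A → Generated 𝒢 B
  full       : Generated 𝒢 (λ _ → Unit.⊤)
  complement : ∀ {A} → Generated 𝒢 A → Generated 𝒢 (∁ A)
  union      : ∀ {A : ℕ → Pred J ℓ} → (∀ n → Generated 𝒢 (A n)) →
               Generated 𝒢 (⋃ ℕ A)

module _ {J : Set ℓ} (d : J → J → ℝ⁺∞ 0ℓ) where

  IsMetric : Set (lsuc 0ℓ ⊔ ℓ)
  IsMetric = IsGeneralMetric _≡_ _≈_ _≤_ 0# _+_ d × (∀ x y → Finite (d x y))

  Open : Pred (Pred J ℓ) ℓ
  Open U = ∀ x → U x → ∃ λ ε → 0ℚ ℚ.< ε × (∀ y → d x y ≺ ε → U y)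

  Cauchy : Pred (ℕ → J) 0ℓ
  Cauchy x = ∀ ε → 0ℚ ℚ.< ε →
    ∃ λ N → ∀ m n → N ℕ.≤ m → N ℕ.≤ n → d (x m) (x n) ≺ ε

  _ConvergesTo_ : (ℕ → J) → J → Set
  x ConvergesTo y = ∀ ε → 0ℚ ℚ.< ε → ∃ λ N → ∀ n → N ℕ.≤ n → d (x n) y ≺ ε

  Complete : Set ℓ
  Complete = ∀ x → Cauchy x → ∃ λ y → x ConvergesTo y

  -- Maybe allows the countable dense set to be empty.
  Separable : Set ℓ
  Separable = ∃ λ (s : ℕ → Maybe J) →
    ∀ x ε → 0ℚ ℚ.< ε → ∃₂ λ n y → s n ≡ just y × d x y ≺ ε

IsStandardBorel : MeasurableSpace ℓ → Set (lsuc ℓ)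
IsStandardBorel M = ∃ λ (d : J → J → ℝ⁺∞ 0ℓ) →
  IsMetric d × Complete d × Separable d × (∀ A → ℬ A ⇔ Generated (Open d) A)
  where open MeasurableSpace M

record StandardBorelProbabilitySpace ℓ : Set (lsuc (lsuc ℓ)) where
  field
    measurableSpace : MeasurableSpace ℓ

  open MeasurableSpace measurableSpace public

  field
    isStandardBorel : IsStandardBorel measurableSpace
    π               : (A : Pred J ℓ) → ℬ A → ℝ⁺∞ 0ℓ
    π-cong          : ∀ {A B} (mA : ℬ A) (mB : ℬ B) → A ≐ B → π A mA ≈ π B mB
    π-empty         : ∀ mA → π (λ _ → Empty.⊥) mA ≈ 0# {0ℓ}
    π-additive      : ∀ {A : ℕ → Pred J ℓ} (mA : ∀ n → ℬ (A n)) →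
                      (∀ m n → ¬ m ≡ n → Empty (A m ∩ A n)) →
                      π (⋃ ℕ A) (ℬ-⋃ mA) ≈ ∑∞ (λ n → π (A n) (mA n))
    π-full          : π (λ _ → Unit.⊤) ℬ-full ≈ 1#

------------------------------------------------------------------------
-- Expectation

module Integral (Ω : StandardBorelProbabilitySpace ℓ) where
  open StandardBorelProbabilitySpace Ω

  record Term : Set (lsuc ℓ) where
    field
      coefficient    : ℚ
      nonNegative    : 0ℚ ℚ.≤ coefficient
      support        : Pred J ℓ
      measurable     : ℬ support

  open Term

  -- Simple functions ∑ cᵢ 𝟙(Aᵢ).  Since ℚ is dense in ℝ, rational
  -- coefficients give the same supremum in the definition of E.
  Simple : Set (lsuc ℓ)
  Simple = List Term

  value : Simple → J → ℝ⁺∞ ℓ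
  value s x = List.foldr (λ t y → coefficient t · 𝟙 (support t) x + y) 0# s

  E-simple : Simple → ℝ⁺∞ 0ℓ
  E-simple = List.foldr
    (λ t y → coefficient t · π (support t) (measurable t) + y) 0#

  -- The Lebesgue integral of f with respect to π when f is measurable (in
  -- general, the lower integral).
  E : (J → ℝ⁺∞ ℓ) → ℝ⁺∞ (lsuc ℓ)
  E f = ⨆ (∃ λ s → ∀ x → value s x ≤ f x) (E-simple ∘ proj₁)

------------------------------------------------------------------------
-- Partitions

-- A partition is given by the equivalence relation of lying in the same class.
record Partition (J : Set ℓ) : Set (lsuc ℓ) where
  field
    _∼_           : Rel J ℓ
    isEquivalence : IsEquivalence _∼_

  open IsEquivalence isEquivalence public
    renaming (refl to ∼-refl; sym to ∼-sym; trans to ∼-trans)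

  class : J → Pred J ℓ
  class x = x ∼_

  -- 𝒫(X): y lies in the union of the classes meeting X iff its own class
  -- meets X.
  saturation : Pred J ℓ → Pred J ℓ
  saturation X y = class y ≬ X

open Partition using (class; saturation)

module _ {J : Set ℓ} where

  infix 4 _≼ᵖ_
  infixr 6 _∨ᵖ_

  _≼ᵖ_ : Rel (Partition J) ℓ
  R ≼ᵖ P = ∀ x → ∃ λ y → class R x ⊆ class P y

  _∨ᵖ_ : Partition J → Partition J → Partition J
  P ∨ᵖ Q = record
    { _∼_           = Eq.EqClosure (P._∼_ ∪ᵣ Q._∼_)
    ; isEquivalence = Eq.isEquivalence (P._∼_ ∪ᵣ Q._∼_)
    }
    where
    module P = Partition P
    module Q = Partition Q

  ∨ᵖ-supremum : Supremum _≼ᵖ_ _∨ᵖ_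
  ∨ᵖ-supremum P Q =
      (λ x → x , λ x∼y → Eq.return (inj₁ x∼y))
    , (λ x → x , λ x∼y → Eq.return (inj₂ x∼y))
    , λ S P≼S Q≼S x → x ,
        Eq.fold (Partition.isEquivalence S) [ ≼⇒⊆ P S P≼S , ≼⇒⊆ Q S Q≼S ]
    where
    ≼⇒⊆ : ∀ R S → R ≼ᵖ S → ∀ {x y} → Partition._∼_ R x y → Partition._∼_ S x y
    ≼⇒⊆ R S R≼S {x} x∼y =
      let z , f = R≼S x in
      Partition.∼-trans S (Partition.∼-sym S (f (Partition.∼-refl R))) (f x∼y)

record BPartition (M : MeasurableSpace ℓ) : Set (lsuc ℓ) where
  open MeasurableSpace M
  field
    partition    : Partition J
    ℬ-saturation : ∀ {A} → ℬ A → ℬ (saturation partition A)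

  open Partition partition public

open BPartition using (partition)

module _ {M : MeasurableSpace ℓ} where
  open MeasurableSpace M

  infix 4 _≼_
  infixr 6 _∨_

  _≼_ : Rel (BPartition M) ℓ
  _≼_ = _≼ᵖ_ on partition

  -- The join is again a ℬ-partition, because (𝒫 ∨ 𝒬)(A) = ⋃ₙ (𝒬𝒫)ⁿ(A).
  _∨_ : BPartition M → BPartition M → BPartition M
  P ∨ Q = record
    { partition    = P∨Q
    ; ℬ-saturation = λ {A} mA →
        ℬ-resp ((λ (n , y∈) → iter⊆ n y∈) , λ (z , y∼z , z∈A) → ⊆iter y∼z z∈A)
               (ℬ-⋃ (ℬ-iter mA))
    }
    where
    module P = BPartition P
    module Q = BPartition Q

    P∨Q : Partition J
    P∨Q = P.partition ∨ᵖ Q.partition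
    module P∨Q = Partition P∨Q

    iter : Pred J ℓ → ℕ → Pred J ℓ
    iter A zero    = A
    iter A (suc n) = Q.saturation (P.saturation (iter A n))

    ℬ-iter : ∀ {A} → ℬ A → ∀ n → ℬ (iter A n)
    ℬ-iter mA zero    = mA
    ℬ-iter mA (suc n) = Q.ℬ-saturation (P.ℬ-saturation (ℬ-iter mA n))

    iter⊆ : ∀ {A} n → iter A n ⊆ P∨Q.saturation A
    iter⊆ zero {y} y∈A = y , P∨Q.∼-refl , y∈A
    iter⊆ (suc n) (z , y∼z , w , z∼w , w∈) =
      let v , w∼v , v∈A = iter⊆ n w∈ in
      v , fwd (inj₂ y∼z) ◅ fwd (inj₁ z∼w) ◅ w∼v , v∈A

    ⊆iter : ∀ {A y z} → y P∨Q.∼ z → A z → ⋃ ℕ (iter A) y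
    ⊆iter ε z∈A = 0 , z∈A
    ⊆iter {y = y} (_◅_ {j = w} s w∼z) z∈A =
      let n , w∈ = ⊆iter w∼z z∈A in suc n , step s w∈
      where
      step : ∀ {B} → SymClosure (P._∼_ ∪ᵣ Q._∼_) y w → B w →
             Q.saturation (P.saturation B) y
      step (fwd (inj₁ p)) b = y , Q.∼-refl , w , p , b
      step (bwd (inj₁ p)) b = y , Q.∼-refl , w , P.∼-sym p , b
      step (fwd (inj₂ q)) b = w , q , w , P.∼-refl , b
      step (bwd (inj₂ q)) b = w , Q.∼-sym q , w , P.∼-refl , b

------------------------------------------------------------------------
-- Re-randomizing and ψ

module _ {J : Set ℓ} where

  record Enumeration (A : Pred J ℓ) (n : ℕ) : Set ℓ where
    field
      point     : Fin n → J
      injective : Injective _≡_ _≡_ point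
      sound     : ∀ k → A (point k)
      complete  : ∀ {x} → A x → ∃ λ k → point k ≡ x

  -- A is finite and non-empty, with k + 1 elements.
  FiniteNonEmpty : Pred (Pred J ℓ) ℓ
  FiniteNonEmpty A = ∃ λ k → Enumeration A (suc k)

  -- 1/|A| for non-empty A.  All enumerations of A have the same length, so
  -- the supremum is over a constant family, which is empty when A is infinite.
  1/∣_∣ : Pred J ℓ → ℝ⁺∞ ℓ
  1/∣ A ∣ = ⨆ (FiniteNonEmpty A) λ (k , _) → fromℚ (+ 1 ℚ./ suc k)

  -- μₓ(A): the proportion of points of 𝒫ₓ in A if 𝒫ₓ is finite, and δₓ(A)
  -- otherwise.  As above, the supremum is over a constant family.
  μ : Partition J → J → Pred J ℓ → ℝ⁺∞ ℓ
  μ P x A = ⨆ (FiniteNonEmpty (class P x) ⊎ ¬ FiniteNonEmpty (class P x))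
    [ (λ (k , e) → (+ 1 ℚ./ suc k) · ∑ (𝟙 A ∘ Enumeration.point e))
    , (λ _ → 𝟙 A x) ]

module _ (Ω : StandardBorelProbabilitySpace ℓ) where
  open StandardBorelProbabilitySpace Ω
  open Integral Ω

  -- The integrands below are measurable because ℬ is countably generated and
  -- separates points.

  ReRandomizing : Pred (BPartition measurableSpace) (lsuc ℓ)
  ReRandomizing P = ∀ A (mA : ℬ A) → E (λ x → μ (partition P) x A) ≈ π A mA

  ψ : BPartition measurableSpace → ℝ⁺∞ (lsuc ℓ)
  ψ P = E λ u → 1/∣ class (partition P) u ∣

module Submission where

-- View the classes of 𝒫 and of 𝒬 as the two sides of a bipartite graph whose
-- edges are the classes of ℛ; the classes of 𝒫 ∨ 𝒬 are its components.  Up to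
-- the re-randomizing property, ψ counts vertices, edges and components, so the
-- claim is that edges + components ≥ vertices.
--
-- Call infinite vertices roots; they do not contribute to ψ.  In the components
-- without infinite vertices, choose a measurable set B of points meeting every
-- component and let the 𝒫-classes meeting B be roots.  Every other vertex v
-- contains an edge to a vertex nearer to the roots, and these edges are distinct
-- for distinct v.  Hence ψ(𝒫) + ψ(𝒬) ≤ ψ(ℛ) + π(B).
--
-- Cutting down repeatedly along a sequence of balls which separates points, B can
-- be taken to decrease to a set Z with at most one point in every component.  The
-- re-randomizing property moves Z around its components without decreasing its
-- measure, so k π(Z) ≤ 1 on components with at least k points, and more precisely
-- π(Z) ≤ ψ(𝒫 ∨ 𝒬).

open import Defs
open import Axiom.ExcludedMiddle using (ExcludedMiddle)

open import Algebra.Bundles using (CommutativeMonoid)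
import Algebra.Properties.CommutativeSemigroup as CommutativeSemigroup
open import Data.Empty using (⊥-elim)
import Data.Empty.Polymorphic as Empty
open import Data.Fin.Base using (Fin; zero; suc; toℕ; punchIn; punchOut)
open import Data.Fin.Properties as Fin
  using (any?; punchIn-injective; punchInᵢ≢i; punchOut-injective; punchIn-punchOut; injective⇒≤; suc-injective)
open import Data.Integer.Base as ℤ using (+_)
import Data.Integer.Properties as ℤ
open import Data.List.Base as List using (List; []; _∷_)
open import Data.List.Membership.Propositional using () renaming (_∈_ to _∈ˡ_)
open import Data.List.Membership.Propositional.Properties using (∈-concatMap⁺; ∈-tabulate⁺)
open import Data.List.Relation.Unary.Any as Any using (Any; here; there)
open import Data.Maybe.Base using (Maybe; just)
open import Data.Maybe.Properties using (just-injective)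
open import Data.Nat.Base as ℕ using (ℕ; zero; suc)
import Data.Nat.Properties as ℕ
open import Data.Product.Base using (∃; ∃₂; _×_; _,_; proj₁; proj₂)
open import Data.Rational.Base as ℚ using (ℚ; 0ℚ; 1ℚ; ½)
import Data.Rational.Properties as ℚ
open import Data.Rational.Solver using (module +-*-Solver)
import Data.Rational.Unnormalised.Base as ℚᵘ
import Data.Rational.Unnormalised.Properties as ℚᵘ
open import Data.Sum.Base as Sum using (_⊎_; inj₁; inj₂; [_,_])
import Data.Unit.Polymorphic.Base as Unit
open import Function.Base using (_∘_)
open import Function.Bundles using (Equivalence)
open import Function.Definitions using (Injective)
open import Function.Metric.Structures using (IsGeneralMetric)
open import Level using (Level; _⊔_; Lift; lift; 0ℓ) renaming (suc to lsuc)
import Relation.Binary.Construct.Closure.Equivalence as Eq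
open import Relation.Binary.Construct.Closure.ReflexiveTransitive using (ε; _◅_)
open import Relation.Binary.Construct.Closure.Symmetric using (fwd; bwd)
open import Relation.Binary.Definitions using (tri<; tri≈; tri>)
open import Relation.Binary.PropositionalEquality
  using (_≡_; _≢_; refl; sym; trans; cong; subst; subst₂)
open import Relation.Nullary.Decidable.Core using (Dec; yes; no; decidable-stable)
open import Relation.Nullary.Negation.Core using (¬_; contradiction)
open import Relation.Unary using (Pred)

open ℝ⁺∞

-- Components may be infinite, and a measurable set with exactly one point in each of them need not
-- exist: the limit `Z` can miss components, so a forest rooted at `Z` would not reach everything.
-- For this reason the forest estimate is proved for an arbitrary measurable `B` meeting every
-- locally finite component, is applied to each stage of the selection, and only the resulting
-- numerical inequality is passed to the limit.
--
-- Re-randomizing is given for 𝒫 and 𝒬, not for their join, so `Z` cannot be compared with its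
-- components in one step. It is moved instead by alternate 𝒫- and 𝒬-steps, which is possible where
-- all these classes are finite. The copies are made disjoint one after the other. In a component of
-- `k + 1` points there is room for `k + 1` of them, which is where the weight 1/(k + 1) in ψ comes
-- from; in an infinite component there is room for any number, so `Z` is null there.

private
  variable
    a b c i ℓ : Level

-- Wrapping _≤_ and _≈_ in records lets their arguments be inferred.

infix 4 _⊑_ _≋_

record _⊑_ (x : ℝ⁺∞ a) (y : ℝ⁺∞ b) : Set (a ⊔ b) where
  constructor ⊑-intro
  field apply : x ≤ y

open _⊑_ public

record _≋_ (x : ℝ⁺∞ a) (y : ℝ⁺∞ b) : Set (a ⊔ b) where
  constructor _,_
  field
    ≋⇒⊑ : x ⊑ y
    ≋⇒⊒ : y ⊑ x

open _≋_ public

⊑-refl : {x : ℝ⁺∞ a} → x ⊑ x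
⊑-refl .apply p = p

⊑-trans : {x : ℝ⁺∞ a} {y : ℝ⁺∞ b} {z : ℝ⁺∞ c} → x ⊑ y → y ⊑ z → x ⊑ z
⊑-trans f g .apply p = apply g (apply f p)

≋-refl : {x : ℝ⁺∞ a} → x ≋ x
≋-refl = ⊑-refl , ⊑-refl

≋-sym : {x : ℝ⁺∞ a} {y : ℝ⁺∞ b} → x ≋ y → y ≋ x
≋-sym (f , g) = g , f

≋-trans : {x : ℝ⁺∞ a} {y : ℝ⁺∞ b} {z : ℝ⁺∞ c} → x ≋ y → y ≋ z → x ≋ z
≋-trans (f , g) (h , k) = ⊑-trans f h , ⊑-trans k g

≈⇒≋ : {x : ℝ⁺∞ a} {y : ℝ⁺∞ b} → x ≈ y → x ≋ y
≈⇒≋ (f , g) = ⊑-intro f , ⊑-intro g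

-- Rationals

<-split : ∀ p q → p ℚ.+ (q ℚ.- p) ≡ q
<-split = solve 2 (λ p q → p :+ (q :- p) := q) refl
  where open +-*-Solver

p<q⇒p-q<0 : ∀ {p q} → p ℚ.< q → p ℚ.- q ℚ.< 0ℚ
p<q⇒p-q<0 {p} {q} p<q =
  subst (p ℚ.- q ℚ.<_) (ℚ.+-inverseʳ q) (ℚ.+-monoˡ-< (ℚ.- q) p<q)

p<q⇒0<q-p : ∀ {p q} → p ℚ.< q → 0ℚ ℚ.< q ℚ.- p
p<q⇒0<q-p {p} {q} p<q =
  subst (ℚ._< q ℚ.- p) (ℚ.+-inverseʳ p) (ℚ.+-monoˡ-< (ℚ.- p) p<q)

p≤q⇒0≤q-p : ∀ {p q} → p ℚ.≤ q → 0ℚ ℚ.≤ q ℚ.- p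
p≤q⇒0≤q-p {p} {q} p≤q =
  subst (ℚ._≤ q ℚ.- p) (ℚ.+-inverseʳ p) (ℚ.+-monoˡ-≤ (ℚ.- p) p≤q)

*-monoˡ-≤ : ∀ {r p q} → 0ℚ ℚ.≤ r → p ℚ.≤ q → r ℚ.* p ℚ.≤ r ℚ.* q
*-monoˡ-≤ {r} 0≤r = ℚ.*-monoˡ-≤-nonNeg r {{ℚ.nonNegative 0≤r}}

*-monoˡ-< : ∀ {r p q} → 0ℚ ℚ.< r → p ℚ.< q → r ℚ.* p ℚ.< r ℚ.* q
*-monoˡ-< {r} 0<r = ℚ.*-monoʳ-<-pos r {{ℚ.positive 0<r}}

*-pos : ∀ {r s} → 0ℚ ℚ.< r → 0ℚ ℚ.< s → 0ℚ ℚ.< r ℚ.* s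
*-pos {r} {s} 0<r 0<s = subst (ℚ._< r ℚ.* s) (ℚ.*-zeroʳ r) (*-monoˡ-< 0<r 0<s)

≤⇒<∨≡ : ∀ {p q} → p ℚ.≤ q → p ℚ.< q ⊎ p ≡ q
≤⇒<∨≡ {p} {q} p≤q with ℚ.<-cmp p q
... | tri< p<q _ _ = inj₁ p<q
... | tri≈ _ p≡q _ = inj₂ p≡q
... | tri> _ _ q<p = contradiction (ℚ.≤-<-trans p≤q q<p) (ℚ.<-irrefl refl)

reciprocal : ∀ {r} → 0ℚ ℚ.< r → ∃ λ s → 0ℚ ℚ.< s × r ℚ.* s ≡ 1ℚ
reciprocal {r} 0<r = ℚ.1/ r , ℚ.positive⁻¹ (ℚ.1/ r) {{ℚ.1/pos⇒pos r}} , ℚ.*-inverseʳ r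
  where
  instance
    _ = ℚ.positive 0<r
    _ = ℚ.pos⇒nonZero r

opaque
  1/suc fromℕ : ℕ → ℚ
  1/suc n = + 1 ℚ./ suc n
  fromℕ n = + n ℚ./ 1

  1/suc-def : ∀ n → 1/suc n ≡ + 1 ℚ./ suc n
  1/suc-def n = refl

  fromℕ-one : fromℕ 1 ≡ 1ℚ
  fromℕ-one = refl

  1/suc-zero : 1/suc 0 ≡ 1ℚ
  1/suc-zero = refl

  0<1/suc : ∀ n → 0ℚ ℚ.< 1/suc n
  0<1/suc n = ℚ.positive⁻¹ _ {{ℚ.normalize-pos 1 (suc n)}}

  fromℕ-zero : fromℕ 0 ≡ 0ℚ
  fromℕ-zero = refl

  fromℕ-suc : ∀ n → fromℕ (suc n) ≡ 1ℚ ℚ.+ fromℕ n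
  fromℕ-suc n = ℚ.toℚᵘ-injective (ℚᵘ.≃-trans (ℚ.toℚᵘ-fromℚᵘ (ℚᵘ.mkℚᵘ (+ suc n) 0))
    (ℚᵘ.≃-sym (ℚᵘ.≃-trans (ℚ.toℚᵘ-homo-+ 1ℚ (fromℕ n))
      (ℚᵘ.≃-trans (ℚᵘ.+-congʳ (ℚ.toℚᵘ 1ℚ) (ℚ.toℚᵘ-fromℚᵘ (ℚᵘ.mkℚᵘ (+ n) 0)))
        (ℚᵘ.*≡* (cong (λ z → (+ 1 ℤ.+ z) ℤ.* + 1) (ℤ.*-identityʳ (+ n))))))))

  fromℕ*1/suc : ∀ n → fromℕ (suc n) ℚ.* 1/suc n ≡ 1ℚ
  fromℕ*1/suc n = ℚ.toℚᵘ-injective (ℚᵘ.≃-trans (ℚ.toℚᵘ-homo-* (fromℕ (suc n)) (1/suc n))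
    (ℚᵘ.≃-trans (ℚᵘ.*-cong (ℚ.toℚᵘ-fromℚᵘ (ℚᵘ.mkℚᵘ (+ suc n) 0)) (ℚ.toℚᵘ-fromℚᵘ (ℚᵘ.mkℚᵘ (+ 1) n)))
      (ℚᵘ.*≡* (trans (ℤ.*-identityʳ _) (trans (ℤ.*-identityʳ (+ suc n))
        (sym (trans (ℤ.*-identityˡ _) (cong (λ m → + suc m) (ℕ.+-identityʳ n)))))))))

  0<fromℕ : ∀ n → 0ℚ ℚ.< fromℕ (suc n)
  0<fromℕ n = ℚ.positive⁻¹ _ {{ℚ.normalize-pos (suc n) 1}}

  0≤fromℕ : ∀ n → 0ℚ ℚ.≤ fromℕ n
  0≤fromℕ zero    = ℚ.≤-refl
  0≤fromℕ (suc n) = ℚ.<⇒≤ (0<fromℕ n)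

opaque
  unfolding 1/suc

  -- A positive fraction has numerator at least 1, so its multiple by the denominator, stored as the
  -- predecessor `d`, is at least 1.
  archimedean : ∀ {r} → 0ℚ ℚ.< r → ∃ λ n → 1ℚ ℚ.≤ fromℕ (suc n) ℚ.* r
  archimedean {r@(ℚ.mkℚ (ℤ.+_ (suc m)) d _)} _ =
    d , subst (ℚ._≤ fromℕ (suc d) ℚ.* r) (fromℕ*1/suc d)
          (*-monoˡ-≤ (0≤fromℕ (suc d)) (ℚ.toℚᵘ-cancel-≤
            (ℚᵘ.≤-respˡ-≃ (ℚᵘ.≃-sym (ℚ.toℚᵘ-fromℚᵘ (ℚᵘ.mkℚᵘ (+ 1) d)))
              (ℚᵘ.*≤* (ℤ.*-monoʳ-≤-nonNeg (+ suc d) (ℤ.+≤+ (ℕ.s≤s (ℕ.z≤n {m}))))))))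
  archimedean {ℚ.mkℚ (ℤ.+_ zero) _ _} (ℚ.*<* p) = ⊥-elim (ℤ.<-irrefl refl p)
  archimedean {ℚ.mkℚ ℤ.-[1+ _ ] _ _} (ℚ.*<* ())

-- The operations of Defs unfold to record expressions, which would block
-- unification; opaque copies behave like constructors.

infixl 6 _⊕_
infixl 7 _⊙_

opaque
  _⊕_ : ℝ⁺∞ a → ℝ⁺∞ a → ℝ⁺∞ a
  x ⊕ y = x + y

  _⊙_ : ℚ → ℝ⁺∞ a → ℝ⁺∞ a
  r ⊙ x = r · x

  𝟘 : ℝ⁺∞ a
  𝟘 = 0#

  𝟏 : ℝ⁺∞ 0ℓ
  𝟏 = 1#

∑< : ℕ → (ℕ → ℝ⁺∞ a) → ℝ⁺∞ a
∑< zero    x = 𝟘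
∑< (suc n) x = x 0 ⊕ ∑< n (x ∘ suc)

opaque
  ∑ᵢ : (ℕ → ℝ⁺∞ a) → ℝ⁺∞ a
  ∑ᵢ x = ⨆ ℕ λ n → ∑< n x

opaque
  unfolding _⊕_ _⊙_ 𝟘 𝟏 ∑ᵢ

  ⊕≋+ : {x y : ℝ⁺∞ a} → x ⊕ y ≋ x + y
  ⊕≋+ = ≋-refl

  ⊙≋· : ∀ {r} {x : ℝ⁺∞ a} → r ⊙ x ≋ r · x
  ⊙≋· = ≋-refl

  𝟘≋0 : 𝟘 {a} ≋ 0# {a}
  𝟘≋0 = ≋-refl

  𝟏≋1 : 𝟏 ≋ 1#
  𝟏≋1 = ≋-refl

  ⊕-intro : ∀ {q r s} {x y : ℝ⁺∞ a} → r <ʳ x → s <ʳ y → q ℚ.≤ r ℚ.+ s → q <ʳ x ⊕ y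
  ⊕-intro r<x s<y q≤ = _ , _ , r<x , s<y , q≤

  ⊕-elim : ∀ {q} {x y : ℝ⁺∞ a} → q <ʳ x ⊕ y → ∃₂ λ r s → r <ʳ x × s <ʳ y × q ℚ.≤ r ℚ.+ s
  ⊕-elim p = p

  ⊙-intro₀ : ∀ {r q} {x : ℝ⁺∞ a} → q ℚ.< 0ℚ ⊎ (∃ λ s → s <ʳ x × q ℚ.< r ℚ.* s) → q <ʳ r ⊙ x
  ⊙-intro₀ p = p

  ⊙-elim₀ : ∀ {r q} {x : ℝ⁺∞ a} → q <ʳ r ⊙ x → q ℚ.< 0ℚ ⊎ (∃ λ s → s <ʳ x × q ℚ.< r ℚ.* s)
  ⊙-elim₀ p = p

  𝟘-intro : ∀ {q} → q ℚ.< 0ℚ → q <ʳ 𝟘 {a}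
  𝟘-intro = lift

  𝟘-elim : ∀ {q} → q <ʳ 𝟘 {a} → q ℚ.< 0ℚ
  𝟘-elim = Level.lower

  ∑<⊑∑ᵢ : ∀ {x : ℕ → ℝ⁺∞ a} n → ∑< n x ⊑ ∑ᵢ x
  ∑<⊑∑ᵢ n .apply q< = inj₂ (n , q<)

  ∑ᵢ-elim : ∀ {x : ℕ → ℝ⁺∞ a} {q} → q <ʳ ∑ᵢ x → ∃ λ n → q <ʳ ∑< n x
  ∑ᵢ-elim (inj₁ q<0) = 0 , lift q<0
  ∑ᵢ-elim (inj₂ p)   = p

  ∑<≋∑ : ∀ {x : ℕ → ℝ⁺∞ a} n → ∑< n x ≋ ∑ {n = n} (x ∘ toℕ)
  ∑<≋∑ {x = x} zero    = ≋-refl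
  ∑<≋∑ {x = x} (suc n) = cong-+ {x = x 0} {y = ∑< n (x ∘ suc)} {z = ∑ {n = n} (x ∘ suc ∘ toℕ)} (∑<≋∑ n)
    where
    cong-+ : ∀ {x y z : ℝ⁺∞ a} → y ≋ z → x + y ≋ x + z
    cong-+ (f , g) = ⊑-intro (λ (r , s , r<x , s<y , q≤) → r , s , r<x , apply f s<y , q≤)
                   , ⊑-intro (λ (r , s , r<x , s<y , q≤) → r , s , r<x , apply g s<y , q≤)

  ∑ᵢ≋∑∞ : ∀ {x : ℕ → ℝ⁺∞ a} → ∑ᵢ x ≋ ∑∞ x
  ∑ᵢ≋∑∞ {x = x} =
      ⊑-intro [ inj₁ , (λ (n , q<) → inj₂ (n , apply (≋⇒⊑ (∑<≋∑ {x = x} n)) q<)) ]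
    , ⊑-intro [ inj₁ , (λ (n , q<) → inj₂ (n , apply (≋⇒⊒ (∑<≋∑ {x = x} n)) q<)) ]

0⊑ : {x : ℝ⁺∞ b} → 𝟘 {a} ⊑ x
0⊑ {x = x} .apply q< = negative x (𝟘-elim q<)

-- Addition

+-mono : {x y x′ y′ : ℝ⁺∞ a} → x ⊑ x′ → y ⊑ y′ → x ⊕ y ⊑ x′ ⊕ y′
+-mono f g .apply p =
  let r , s , r<x , s<y , q≤ = ⊕-elim p in ⊕-intro (apply f r<x) (apply g s<y) q≤

+-monoˡ : {x y z : ℝ⁺∞ a} → x ⊑ y → x ⊕ z ⊑ y ⊕ z
+-monoˡ f = +-mono f ⊑-refl

+-monoʳ : {x y z : ℝ⁺∞ a} → x ⊑ y → z ⊕ x ⊑ z ⊕ y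
+-monoʳ = +-mono ⊑-refl

+-comm-⊑ : {x y : ℝ⁺∞ a} → x ⊕ y ⊑ y ⊕ x
+-comm-⊑ .apply {q} p =
  let r , s , r<x , s<y , q≤ = ⊕-elim p in ⊕-intro s<y r<x (subst (q ℚ.≤_) (ℚ.+-comm r s) q≤)

+-assoc-⊑ : {x y z : ℝ⁺∞ a} → (x ⊕ y) ⊕ z ⊑ x ⊕ (y ⊕ z)
+-assoc-⊑ .apply {q} p =
  let r , s , r< , s<z , q≤ = ⊕-elim p
      t , u , t<x , u<y , r≤ = ⊕-elim r<
  in ⊕-intro t<x (⊕-intro u<y s<z ℚ.≤-refl)
       (subst (q ℚ.≤_) (ℚ.+-assoc t u s) (ℚ.≤-trans q≤ (ℚ.+-monoˡ-≤ s r≤)))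

+-assoc-⊒ : {x y z : ℝ⁺∞ a} → x ⊕ (y ⊕ z) ⊑ (x ⊕ y) ⊕ z
+-assoc-⊒ = ⊑-trans +-comm-⊑ (⊑-trans (+-monoˡ +-comm-⊑)
  (⊑-trans +-assoc-⊑ (⊑-trans +-comm-⊑ (+-monoˡ +-comm-⊑))))

x⊑0+x : {x : ℝ⁺∞ a} → x ⊑ 𝟘 ⊕ x
x⊑0+x {x = x} .apply {q} q<x =
  let r , q<r , r<x = rounded x q<x in
  ⊕-intro (𝟘-intro (p<q⇒p-q<0 q<r)) r<x
    (ℚ.≤-reflexive (sym (trans (ℚ.+-comm (q ℚ.- r) r) (<-split r q))))

0+x⊑x : {x : ℝ⁺∞ a} → 𝟘 ⊕ x ⊑ x
0+x⊑x {x = x} .apply {q} p =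
  let r , s , r<0 , s<x , q≤ = ⊕-elim p in
  downward x (ℚ.≤-<-trans q≤ (subst (r ℚ.+ s ℚ.<_) (ℚ.+-identityˡ s) (ℚ.+-monoˡ-< s (𝟘-elim r<0)))) s<x

x⊑y+x : {x y : ℝ⁺∞ a} → x ⊑ y ⊕ x
x⊑y+x = ⊑-trans x⊑0+x (+-monoˡ 0⊑)

x⊑x+y : {x y : ℝ⁺∞ a} → x ⊑ x ⊕ y
x⊑x+y = ⊑-trans x⊑y+x +-comm-⊑

x+y⊑x : ∀ {a} {x y : ℝ⁺∞ a} → y ⊑ 𝟘 {a} → x ⊕ y ⊑ x
x+y⊑x f = ⊑-trans (+-monoʳ f) (⊑-trans +-comm-⊑ 0+x⊑x)

+-commutativeMonoid : ∀ a → CommutativeMonoid (lsuc a) a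
+-commutativeMonoid a = record
  { Carrier = ℝ⁺∞ a
  ; _≈_ = _≋_
  ; _∙_ = _⊕_
  ; ε = 𝟘
  ; isCommutativeMonoid = record
    { isMonoid = record
      { isSemigroup = record
        { isMagma = record
          { isEquivalence = record { refl = ≋-refl ; sym = ≋-sym ; trans = ≋-trans }
          ; ∙-cong = λ (f , g) (h , k) → +-mono f h , +-mono g k
          }
        ; assoc = λ x y z → +-assoc-⊑ , +-assoc-⊒
        }
      ; identity = (λ x → 0+x⊑x , x⊑0+x)
                 , (λ x → ⊑-trans +-comm-⊑ 0+x⊑x , ⊑-trans x⊑0+x +-comm-⊑)
      }
    ; comm = λ x y → +-comm-⊑ , +-comm-⊑
    }
  }

-- Scalar multiplication

·-mono : ∀ {r} {x : ℝ⁺∞ a} {y : ℝ⁺∞ a} → x ⊑ y → r ⊙ x ⊑ r ⊙ y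
·-mono f .apply p with ⊙-elim₀ p
... | inj₁ q<0 = ⊙-intro₀ (inj₁ q<0)
... | inj₂ (s , s<x , q<) = ⊙-intro₀ (inj₂ (s , apply f s<x , q<))

·-intro : ∀ {r s q} {x : ℝ⁺∞ a} → 0ℚ ℚ.< r → s <ʳ x → q ℚ.≤ r ℚ.* s → q <ʳ r ⊙ x
·-intro {x = x} 0<r s<x q≤ =
  let t , s<t , t<x = rounded x s<x in
  ⊙-intro₀ (inj₂ (t , t<x , ℚ.≤-<-trans q≤ (*-monoˡ-< 0<r s<t)))

·-elim : ∀ {r q} {x : ℝ⁺∞ a} → 0ℚ ℚ.< r → q <ʳ r ⊙ x → ∃ λ s → s <ʳ x × q ℚ.≤ r ℚ.* s
·-elim {r = r} {q} {x} 0<r p with ⊙-elim₀ p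
... | inj₂ (s , s<x , q<) = s , s<x , ℚ.<⇒≤ q<
... | inj₁ q<0 =
  let t , 0<t , rt≡1 = reciprocal 0<r in
  t ℚ.* q , negative x (subst (t ℚ.* q ℚ.<_) (ℚ.*-zeroʳ t) (*-monoˡ-< 0<t q<0)) ,
  ℚ.≤-reflexive (sym (trans (sym (ℚ.*-assoc r t q)) (trans (cong (ℚ._* q) rt≡1) (ℚ.*-identityˡ q))))

0·x⊑0 : {x : ℝ⁺∞ a} → 0ℚ ⊙ x ⊑ 𝟘 {a}
0·x⊑0 .apply {q} p with ⊙-elim₀ p
... | inj₁ q<0 = 𝟘-intro q<0
... | inj₂ (s , _ , q<) = 𝟘-intro (subst (q ℚ.<_) (ℚ.*-zeroˡ s) q<)

r·0⊑0 : ∀ {r} → 0ℚ ℚ.≤ r → r ⊙ 𝟘 {a} ⊑ 𝟘 {a}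
r·0⊑0 {r = r} 0≤r .apply {q} p with ⊙-elim₀ p
... | inj₁ q<0 = 𝟘-intro q<0
... | inj₂ (s , s<0 , q<) = 𝟘-intro
  (ℚ.<-≤-trans q< (subst (r ℚ.* s ℚ.≤_) (ℚ.*-zeroʳ r) (*-monoˡ-≤ 0≤r (ℚ.<⇒≤ (𝟘-elim s<0)))))

1·x≋x : {x : ℝ⁺∞ a} → 1ℚ ⊙ x ≋ x
1·x≋x {x = x} = ⊑-intro f , ⊑-intro g
  where
  f : 1ℚ ⊙ x ≤ x
  f {q} p with ⊙-elim₀ p
  ... | inj₁ q<0 = negative x q<0
  ... | inj₂ (s , s<x , q<) = downward x (subst (q ℚ.<_) (ℚ.*-identityˡ s) q<) s<x
  g : x ≤ 1ℚ ⊙ x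
  g {q} q<x = ·-intro (ℚ.positive⁻¹ 1ℚ) q<x (ℚ.≤-reflexive (sym (ℚ.*-identityˡ q)))

·-distribˡ-⊑ : ∀ {r} {x y : ℝ⁺∞ a} → 0ℚ ℚ.≤ r → r ⊙ (x ⊕ y) ⊑ r ⊙ x ⊕ r ⊙ y
·-distribˡ-⊑ {r = r} {x} {y} 0≤r with ≤⇒<∨≡ 0≤r
... | inj₂ refl = ⊑-trans 0·x⊑0 0⊑
... | inj₁ 0<r = ⊑-intro λ {q} p →
  let s , s< , q≤ = ·-elim 0<r p
      t , u , t<x , u<y , s≤ = ⊕-elim s<
  in ⊕-intro (·-intro 0<r t<x ℚ.≤-refl) (·-intro 0<r u<y ℚ.≤-refl)
       (subst (q ℚ.≤_) (ℚ.*-distribˡ-+ r t u) (ℚ.≤-trans q≤ (*-monoˡ-≤ 0≤r s≤)))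

·-distribˡ-⊒ : ∀ {r} {x y : ℝ⁺∞ a} → 0ℚ ℚ.≤ r → r ⊙ x ⊕ r ⊙ y ⊑ r ⊙ (x ⊕ y)
·-distribˡ-⊒ {r = r} {x} {y} 0≤r with ≤⇒<∨≡ 0≤r
... | inj₂ refl = ⊑-trans (+-mono 0·x⊑0 0·x⊑0) (⊑-trans 0+x⊑x 0⊑)
... | inj₁ 0<r = ⊑-intro λ {q} p →
  let s , t , s<rx , t<ry , q≤ = ⊕-elim p
      u , u<x , s≤ = ·-elim 0<r s<rx
      v , v<y , t≤ = ·-elim 0<r t<ry
  in ·-intro 0<r (⊕-intro u<x v<y ℚ.≤-refl)
       (subst (q ℚ.≤_) (sym (ℚ.*-distribˡ-+ r u v)) (ℚ.≤-trans q≤ (ℚ.+-mono-≤ s≤ t≤)))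

·-distribʳ-⊒ : ∀ {r s} {x : ℝ⁺∞ a} → 0ℚ ℚ.≤ r → 0ℚ ℚ.≤ s → r ⊙ x ⊕ s ⊙ x ⊑ (r ℚ.+ s) ⊙ x
·-distribʳ-⊒ {r = r} {s} {x} 0≤r 0≤s with ≤⇒<∨≡ 0≤r | ≤⇒<∨≡ 0≤s
... | inj₂ refl | _ = ⊑-trans (+-monoˡ 0·x⊑0)
  (⊑-trans 0+x⊑x (subst (λ t → s ⊙ x ⊑ t ⊙ x) (sym (ℚ.+-identityˡ s)) ⊑-refl))
... | inj₁ _ | inj₂ refl = ⊑-trans (+-monoʳ 0·x⊑0)
  (⊑-trans +-comm-⊑ (⊑-trans 0+x⊑x (subst (λ t → r ⊙ x ⊑ t ⊙ x) (sym (ℚ.+-identityʳ r)) ⊑-refl)))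
... | inj₁ 0<r | inj₁ 0<s = ⊑-intro f
  where
  -- The two summands come with different approximations `v` and `w` of `x`; the larger one, `z`,
  -- serves for both.
  combine : ∀ {q t u v w z} → t ℚ.≤ r ℚ.* v → u ℚ.≤ s ℚ.* w → q ℚ.≤ t ℚ.+ u →
            v ℚ.≤ z → w ℚ.≤ z → z <ʳ x → q <ʳ (r ℚ.+ s) ⊙ x
  combine {q} {z = z} t≤ u≤ q≤ v≤z w≤z z<x = ·-intro (ℚ.+-mono-< 0<r 0<s) z<x
    (subst (q ℚ.≤_) (sym (ℚ.*-distribʳ-+ z r s)) (ℚ.≤-trans q≤ (ℚ.+-mono-≤
      (ℚ.≤-trans t≤ (*-monoˡ-≤ 0≤r v≤z)) (ℚ.≤-trans u≤ (*-monoˡ-≤ 0≤s w≤z)))))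
  f : r ⊙ x ⊕ s ⊙ x ≤ (r ℚ.+ s) ⊙ x
  f p with ⊕-elim p
  ... | t , u , t< , u< , q≤ with ·-elim 0<r t< | ·-elim 0<s u<
  ... | v , v<x , t≤ | w , w<x , u≤ with ℚ.≤-total v w
  ... | inj₁ v≤w = combine t≤ u≤ q≤ v≤w ℚ.≤-refl w<x
  ... | inj₂ w≤v = combine t≤ u≤ q≤ ℚ.≤-refl w≤v v<x

·-distribʳ-⊑ : ∀ {r s} {x : ℝ⁺∞ a} → 0ℚ ℚ.< r → 0ℚ ℚ.< s → (r ℚ.+ s) ⊙ x ⊑ r ⊙ x ⊕ s ⊙ x
·-distribʳ-⊑ {r = r} {s} {x} 0<r 0<s .apply {q} p =
  let t , t<x , q≤ = ·-elim (ℚ.+-mono-< 0<r 0<s) p in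
  ⊕-intro (·-intro 0<r t<x ℚ.≤-refl) (·-intro 0<s t<x ℚ.≤-refl)
    (subst (q ℚ.≤_) (ℚ.*-distribʳ-+ t r s) q≤)

·-assoc : ∀ {r s} {x : ℝ⁺∞ a} → 0ℚ ℚ.< r → 0ℚ ℚ.< s → r ⊙ (s ⊙ x) ≋ (r ℚ.* s) ⊙ x
·-assoc {r = r} {s} {x} 0<r 0<s = ⊑-intro f , ⊑-intro g
  where
  f : r ⊙ (s ⊙ x) ≤ (r ℚ.* s) ⊙ x
  f {q} p =
    let t , t< , q≤ = ·-elim 0<r p
        u , u<x , t≤ = ·-elim 0<s t<
    in ·-intro (*-pos 0<r 0<s) u<x
         (subst (q ℚ.≤_) (sym (ℚ.*-assoc r s u)) (ℚ.≤-trans q≤ (*-monoˡ-≤ (ℚ.<⇒≤ 0<r) t≤)))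
  g : (r ℚ.* s) ⊙ x ≤ r ⊙ (s ⊙ x)
  g {q} p =
    let u , u<x , q≤ = ·-elim (*-pos 0<r 0<s) p
    in ·-intro 0<r (·-intro 0<s u<x ℚ.≤-refl) (subst (q ℚ.≤_) (ℚ.*-assoc r s u) q≤)

·-cancel : ∀ n {x y : ℝ⁺∞ a} → fromℕ (suc n) ⊙ x ⊑ y → x ⊑ 1/suc n ⊙ y
·-cancel n {x} {y} f = ⊑-trans (≋⇒⊒ 1·x≋x)
  (⊑-trans (subst (λ r → r ⊙ x ⊑ 1/suc n ⊙ (fromℕ (suc n) ⊙ x))
    (trans (ℚ.*-comm (1/suc n) (fromℕ (suc n))) (fromℕ*1/suc n))
    (≋⇒⊒ (·-assoc (0<1/suc n) (0<fromℕ n)))) (·-mono f))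

-- Infinite sums

∑<-mono : ∀ {x y : ℕ → ℝ⁺∞ a} n → (∀ k → x k ⊑ y k) → ∑< n x ⊑ ∑< n y
∑<-mono zero    f = 0⊑
∑<-mono (suc n) f = +-mono (f 0) (∑<-mono n (f ∘ suc))

∑<-monoˡ : ∀ {x : ℕ → ℝ⁺∞ a} {m n} → m ℕ.≤ n → ∑< m x ⊑ ∑< n x
∑<-monoˡ ℕ.z≤n       = 0⊑
∑<-monoˡ (ℕ.s≤s m≤n) = +-monoʳ (∑<-monoˡ m≤n)

module _ {a : Level} where
  open CommutativeMonoid (+-commutativeMonoid a) using (assoc; comm; identityˡ; ∙-congˡ; commutativeSemigroup)
  open CommutativeSemigroup commutativeSemigroup using (interchange)

  ∑<-snoc : ∀ {x : ℕ → ℝ⁺∞ a} n → ∑< (suc n) x ≋ ∑< n x ⊕ x n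
  ∑<-snoc {x} zero    = comm (x 0) 𝟘
  ∑<-snoc {x} (suc n) = ≋-trans (∙-congˡ (∑<-snoc n)) (≋-sym (assoc _ _ _))

  ∑<-+ : ∀ {x y : ℕ → ℝ⁺∞ a} n → ∑< n (λ k → x k ⊕ y k) ≋ ∑< n x ⊕ ∑< n y
  ∑<-+ zero    = ≋-sym (identityˡ 𝟘)
  ∑<-+ (suc n) = ≋-trans (∙-congˡ (∑<-+ n)) (interchange _ _ _ _)

∑<-· : ∀ {r} {x : ℕ → ℝ⁺∞ a} n → 0ℚ ℚ.≤ r → r ⊙ ∑< n x ⊑ ∑< n (λ k → r ⊙ x k)
∑<-· zero    0≤r = r·0⊑0 0≤r
∑<-· (suc n) 0≤r = ⊑-trans (·-distribˡ-⊑ 0≤r) (+-monoʳ (∑<-· n 0≤r))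

∑<-·-⊒ : ∀ {r} {x : ℕ → ℝ⁺∞ a} n → 0ℚ ℚ.≤ r → ∑< n (λ k → r ⊙ x k) ⊑ r ⊙ ∑< n x
∑<-·-⊒ zero    0≤r = 0⊑
∑<-·-⊒ (suc n) 0≤r = ⊑-trans (+-monoʳ (∑<-·-⊒ n 0≤r)) (·-distribˡ-⊒ 0≤r)

∑-lub : ∀ {x : ℕ → ℝ⁺∞ a} {y : ℝ⁺∞ b} → (∀ n → ∑< n x ⊑ y) → ∑ᵢ x ⊑ y
∑-lub f .apply p = let n , q< = ∑ᵢ-elim p in apply (f n) q<

∑-mono : ∀ {x y : ℕ → ℝ⁺∞ a} → (∀ k → x k ⊑ y k) → ∑ᵢ x ⊑ ∑ᵢ y
∑-mono f = ∑-lub λ n → ⊑-trans (∑<-mono n f) (∑<⊑∑ᵢ n)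

∑-+-⊒ : ∀ {x y : ℕ → ℝ⁺∞ a} → ∑ᵢ x ⊕ ∑ᵢ y ⊑ ∑ᵢ (λ k → x k ⊕ y k)
∑-+-⊒ .apply p =
  let r , s , r<x , s<y , q≤ = ⊕-elim p
      m , r< = ∑ᵢ-elim r<x
      n , s< = ∑ᵢ-elim s<y
  in apply (∑<⊑∑ᵢ (m ℕ.⊔ n)) (apply (≋⇒⊒ (∑<-+ (m ℕ.⊔ n)))
       (⊕-intro (apply (∑<-monoˡ (ℕ.m≤m⊔n m n)) r<) (apply (∑<-monoˡ (ℕ.m≤n⊔m m n)) s<) q≤))

∑-·-⊑ : ∀ {r} {x : ℕ → ℝ⁺∞ a} → 0ℚ ℚ.≤ r → r ⊙ ∑ᵢ x ⊑ ∑ᵢ (λ k → r ⊙ x k)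
∑-·-⊑ {x = x} 0≤r .apply p with ⊙-elim₀ p
... | inj₁ q<0 = negative (∑ᵢ _) q<0
... | inj₂ (s , s< , q<) =
  let n , s<ₙ = ∑ᵢ-elim s< in
  apply (⊑-trans (∑<-· n 0≤r) (∑<⊑∑ᵢ n)) (⊙-intro₀ (inj₂ (s , s<ₙ , q<)))

∑-·-⊒ : ∀ {r} {x : ℕ → ℝ⁺∞ a} → 0ℚ ℚ.≤ r → ∑ᵢ (λ k → r ⊙ x k) ⊑ r ⊙ ∑ᵢ x
∑-·-⊒ 0≤r = ∑-lub λ n → ⊑-trans (∑<-·-⊒ n 0≤r) (·-mono (∑<⊑∑ᵢ n))

∑-comm-⊑ : ∀ {x : ℕ → ℕ → ℝ⁺∞ a} → ∑ᵢ (λ i → ∑ᵢ (x i)) ⊑ ∑ᵢ (λ j → ∑ᵢ (λ i → x i j))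
∑-comm-⊑ {a} {x} = ∑-lub λ m → ⊑-trans (f m x) (∑-mono λ j → ∑<⊑∑ᵢ m)
  where
  f : ∀ m (x : ℕ → ℕ → ℝ⁺∞ a) → ∑< m (λ i → ∑ᵢ (x i)) ⊑ ∑ᵢ (λ j → ∑< m (λ i → x i j))
  f zero    x = 0⊑
  f (suc m) x = ⊑-trans (+-monoʳ (f m (x ∘ suc))) ∑-+-⊒

∑-head : ∀ {a} {x : ℕ → ℝ⁺∞ a} → ∑ᵢ x ⊑ x 0 ⊕ ∑ᵢ (x ∘ suc)
∑-head = ∑-lub λ { zero → 0⊑ ; (suc n) → +-monoʳ (∑<⊑∑ᵢ n) }

∑⊑0 : ∀ {x : ℕ → ℝ⁺∞ a} → (∀ k → x k ⊑ 𝟘 {a}) → ∑ᵢ x ⊑ 𝟘 {a}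
∑⊑0 {a} {x} f = ∑-lub λ n → g n f
  where
  g : ∀ n {x : ℕ → ℝ⁺∞ a} → (∀ k → x k ⊑ 𝟘 {a}) → ∑< n x ⊑ 𝟘 {a}
  g zero    f = ⊑-refl
  g (suc n) f = ⊑-trans (+-mono (f 0) (g n (f ∘ suc))) 0+x⊑x

-- Archimedean property

1≤q⇒q≮1 : ∀ {q} → 1ℚ ℚ.≤ q → ¬ q <ʳ 𝟏
1≤q⇒q≮1 1≤q q< with apply (≋⇒⊑ 𝟏≋1) q<
... | inj₁ q<0 = ℚ.<-irrefl refl (ℚ.<-trans q<0 (ℚ.<-≤-trans (ℚ.positive⁻¹ 1ℚ) 1≤q))
... | inj₂ q<1 = ℚ.<-irrefl refl (ℚ.<-≤-trans q<1 1≤q)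

module _ (em : ∀ {a} → ExcludedMiddle a) where

  -- Cuts in [0,∞] have no subtraction. Since `z` is bounded, it has an approximation `s` from below
  -- that is good up to the gap `r - q`; what `z` contributes on the right exceeds `s` by at most
  -- this gap, so `y` must supply `q`.
  +-cancelʳ : ∀ {x y z : ℝ⁺∞ a} → z ⊑ 𝟏 → x ⊕ z ⊑ y ⊕ z → x ⊑ y
  +-cancelʳ {x = x} {y} {z} z⊑1 f .apply {q} q<x =
    let r , q<r , r<x = rounded x q<x
        s , s<z , s≮ = approximate (p<q⇒0<q-p q<r)
        t , u , t<y , u<z , ≤t+u = ⊕-elim (apply f (⊕-intro r<x s<z ℚ.≤-refl))
    in downward′ t<y (q≤t q r s t u (ℚ.≮⇒≥ λ v<u → s≮ (downward z v<u u<z)) ≤t+u)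
    where
    downward′ : ∀ {p t} → t <ʳ y → p ℚ.≤ t → p <ʳ y
    downward′ t<y p≤t with ≤⇒<∨≡ p≤t
    ... | inj₁ p<t = downward y p<t t<y
    ... | inj₂ refl = t<y
    q≤t : ∀ q r s t u → u ℚ.≤ s ℚ.+ (r ℚ.- q) → r ℚ.+ s ℚ.≤ t ℚ.+ u → q ℚ.≤ t
    q≤t q r s t u u≤ ≤t+u = subst₂ ℚ._≤_
      (solve 3 (λ q r s → (r :+ s) :+ (:- (s :+ (r :- q))) := q) refl q r s)
      (solve 4 (λ t s r q → (t :+ (s :+ (r :- q))) :+ (:- (s :+ (r :- q))) := t) refl t s r q)
      (ℚ.+-monoˡ-≤ (ℚ.- (s ℚ.+ (r ℚ.- q))) (ℚ.≤-trans ≤t+u (ℚ.+-monoʳ-≤ t u≤)))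
      where open +-*-Solver
    approximate : ∀ {e} → 0ℚ ℚ.< e → ∃ λ s → s <ʳ z × ¬ s ℚ.+ e <ʳ z
    approximate {e} 0<e =
      let n , 1≤ = archimedean 0<e in
      search (suc n) λ p → 1≤q⇒q≮1 1≤ (apply z⊑1 p)
      where
      step : ∀ n → fromℕ n ℚ.* e ℚ.+ e ≡ fromℕ (suc n) ℚ.* e
      step n = trans (solve 2 (λ k e → k :* e :+ e := (con 1ℚ :+ k) :* e) refl (fromℕ n) e)
                     (cong (ℚ._* e) (sym (fromℕ-suc n)))
        where open +-*-Solver
      -- Descent through the multiples of `e` until one lies below `z`; if none does, `- e` is below
      -- `z` because it is negative.
      search : ∀ n → ¬ (fromℕ n ℚ.* e) <ʳ z → ∃ λ s → s <ʳ z × ¬ s ℚ.+ e <ʳ z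
      search zero 0≮ = ℚ.- e , negative z (ℚ.neg-antimono-< 0<e) ,
        λ p → 0≮ (subst (_<ʳ z) (trans (ℚ.+-inverseˡ e)
          (sym (trans (cong (ℚ._* e) fromℕ-zero) (ℚ.*-zeroˡ e)))) p)
      search (suc n) n≮ with em {P = (fromℕ n ℚ.* e) <ʳ z}
      ... | no n≮′ = search n n≮′
      ... | yes n< = fromℕ n ℚ.* e , n< , λ p → n≮ (subst (_<ʳ z) (step n) p)

bounded-multiples⇒0 : ∀ {x : ℝ⁺∞ 0ℓ} → (∀ n → fromℕ (suc n) ⊙ x ⊑ 𝟏) → x ⊑ 𝟘 {b}
bounded-multiples⇒0 {x = x} f .apply {q} q<x with q ℚ.<? 0ℚ
... | yes q<0 = 𝟘-intro q<0
... | no q≮0 =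
  let r , q<r , r<x = rounded x q<x
      n , 1≤ = archimedean (ℚ.≤-<-trans (ℚ.≮⇒≥ q≮0) q<r)
  in ⊥-elim (1≤q⇒q≮1 1≤ (apply (f n) (·-intro (0<fromℕ n) r<x ℚ.≤-refl)))

-- Indicators and counting

𝟙-∈ : ∀ {J : Set ℓ} {A : Pred J a} {x} → A x → 1# ⊑ 𝟙 A x
𝟙-∈ x∈A .apply q< = inj₂ (x∈A , q<)

𝟙⊑1 : ∀ {J : Set ℓ} {A : Pred J a} {x} → 𝟙 A x ⊑ 1#
𝟙⊑1 .apply (inj₁ q<0) = inj₁ q<0
𝟙⊑1 .apply (inj₂ (_ , q<)) = q<

𝟙-∉ : ∀ {J : Set ℓ} {A : Pred J a} {x} → ¬ A x → 𝟙 A x ⊑ 𝟘 {b}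
𝟙-∉ x∉A .apply (inj₁ q<0) = 𝟘-intro q<0
𝟙-∉ x∉A .apply (inj₂ (x∈A , _)) = contradiction x∈A x∉A

fromℚ-0⊑ : {x : ℝ⁺∞ a} → fromℚ 0ℚ ⊑ x
fromℚ-0⊑ {x = x} .apply = [ negative x , negative x ]

0⊑fromℚ : ∀ {r} {x : ℝ⁺∞ a} → x ⊑ 𝟘 {a} → x ⊑ fromℚ r
0⊑fromℚ f = ⊑-trans f 0⊑

fromℚ-· : ∀ {r s} {x : ℝ⁺∞ a} → 0ℚ ℚ.< r → fromℚ s ⊑ x → fromℚ (r ℚ.* s) ⊑ r ⊙ x
fromℚ-· {r = r} {s} {x} 0<r f .apply (inj₁ q<0) = negative (r ⊙ x) q<0
fromℚ-· {r = r} {s} {x} 0<r f .apply {q} (inj₂ q<) with reciprocal 0<r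
... | t , 0<t , rt≡1 = ·-intro 0<r (apply f (inj₂ tq<s)) (ℚ.≤-reflexive (sym eq))
  where
  cancel : ∀ p → t ℚ.* (r ℚ.* p) ≡ p
  cancel p = trans (sym (ℚ.*-assoc t r p))
    (trans (cong (ℚ._* p) (trans (ℚ.*-comm t r) rt≡1)) (ℚ.*-identityˡ p))
  eq : r ℚ.* (t ℚ.* q) ≡ q
  eq = trans (sym (ℚ.*-assoc r t q)) (trans (cong (ℚ._* q) rt≡1) (ℚ.*-identityˡ q))
  tq<s : t ℚ.* q ℚ.< s
  tq<s = subst (t ℚ.* q ℚ.<_) (cancel s) (*-monoˡ-< 0<t q<)

·⊑fromℚ : ∀ {r} {x : ℝ⁺∞ a} → 0ℚ ℚ.≤ r → x ⊑ 1# → r ⊙ x ⊑ fromℚ r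
·⊑fromℚ {r = r} 0≤r f .apply p with ⊙-elim₀ p
... | inj₁ q<0 = inj₁ q<0
... | inj₂ (t , t<x , q<) = inj₂ (ℚ.<-≤-trans q<
  (subst (r ℚ.* t ℚ.≤_) (ℚ.*-identityʳ r) (*-monoˡ-≤ 0≤r (t≤1 (apply f t<x)))))
  where
  t≤1 : ∀ {t} → t ℚ.< 0ℚ ⊎ t ℚ.< 1ℚ → t ℚ.≤ 1ℚ
  t≤1 (inj₁ t<0) = ℚ.≤-trans (ℚ.<⇒≤ t<0) (ℚ.<⇒≤ (ℚ.positive⁻¹ 1ℚ))
  t≤1 (inj₂ t<1) = ℚ.<⇒≤ t<1

fromℚ-+ : ∀ {r s} → fromℚ (r ℚ.+ s) ⊑ fromℚ r ⊕ fromℚ s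
fromℚ-+ {r} {s} .apply {q} (inj₁ q<0) = negative (fromℚ r ⊕ fromℚ s) q<0
fromℚ-+ {r} {s} .apply {q} (inj₂ q<) =
  let t , q-s<t , t<r = ℚ.<-dense q-s<r in
  ⊕-intro (inj₂ t<r) (inj₂ (q-t<s q-s<t)) (ℚ.≤-reflexive (sym (<-split t q)))
  where
  open +-*-Solver
  q-s<r : q ℚ.- s ℚ.< r
  q-s<r = subst (q ℚ.- s ℚ.<_) (solve 2 (λ r s → r :+ s :- s := r) refl r s) (ℚ.+-monoˡ-< (ℚ.- s) q<)
  q-t<s : ∀ {t} → q ℚ.- s ℚ.< t → q ℚ.- t ℚ.< s
  q-t<s {t} p = subst₂ ℚ._<_ (solve 3 (λ q s t → q :- s :+ (s :- t) := q :- t) refl q s t)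
    (<-split t s) (ℚ.+-monoˡ-< (s ℚ.- t) p)

fromℕ-suc-⊑ : ∀ m → fromℚ (fromℕ (suc m)) ⊑ 1# ⊕ fromℚ (fromℕ m)
fromℕ-suc-⊑ m = subst (λ q → fromℚ q ⊑ 1# ⊕ fromℚ (fromℕ m)) (sym (fromℕ-suc m)) (fromℚ-+ {1ℚ} {fromℕ m})

∑-suc : ∀ {n} (v : Fin (suc n) → ℝ⁺∞ a) → ∑ v ≋ v zero ⊕ ∑ (v ∘ suc)
∑-suc v = ≋-sym (⊕≋+ {x = v zero} {y = ∑ (v ∘ suc)})

module _ {J : Set ℓ} where

  record Contains (A : Pred J ℓ) (n : ℕ) : Set ℓ where
    constructor contains
    field
      points   : Fin n → J
      distinct : Injective _≡_ _≡_ points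
      inside   : ∀ i → A (points i)

  open Contains

  contains-cons : ∀ {A : Pred J ℓ} {n x} → A x → (h : Contains A n) → (∀ i → points h i ≢ x) →
                  Contains A (suc n)
  contains-cons {A} {n} {x} x∈A (contains f f-inj f∈A) f≢x = contains g g-inj g∈A
    where
    g : Fin (suc n) → J
    g zero    = x
    g (suc i) = f i
    g-inj : Injective _≡_ _≡_ g
    g-inj {zero}  {zero}  eq = refl
    g-inj {zero}  {suc j} eq = contradiction (sym eq) (f≢x j)
    g-inj {suc i} {zero}  eq = contradiction eq (f≢x i)
    g-inj {suc i} {suc j} eq = cong suc (f-inj eq)
    g∈A : ∀ i → A (g i)
    g∈A zero    = x∈A
    g∈A (suc i) = f∈A i

  contains-tail : ∀ {A : Pred J ℓ} {n} → Contains A (suc n) → Contains A n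
  contains-tail (contains f f-inj f∈A) = contains (f ∘ suc) (suc-injective ∘ f-inj) (f∈A ∘ suc)

  contains-⊆ : ∀ {A B : Pred J ℓ} {n} → (∀ {x} → A x → B x) → Contains A n → Contains B n
  contains-⊆ h (contains f f-inj f∈A) = contains f f-inj λ i → h (f∈A i)

  enumeration⇒contains : ∀ {A : Pred J ℓ} {n} → Enumeration A n → Contains A n
  enumeration⇒contains e = contains point injective sound
    where open Enumeration e

  contains⇒≤ : ∀ {A : Pred J ℓ} {m n} → Enumeration A n → Contains A m → m ℕ.≤ n
  contains⇒≤ e (contains f f-inj f∈A) = injective⇒≤ {f = λ i → proj₁ (complete (f∈A i))} λ {i} {j} eq →
    f-inj (trans (sym (proj₂ (complete (f∈A i)))) (trans (cong point eq) (proj₂ (complete (f∈A j)))))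
    where open Enumeration e

  enumeration-unique : ∀ {A : Pred J ℓ} {m n} → Enumeration A m → Enumeration A n → m ≡ n
  enumeration-unique e e′ =
    ℕ.≤-antisym (contains⇒≤ e′ (enumeration⇒contains e)) (contains⇒≤ e (enumeration⇒contains e′))

  enumeration-resp : ∀ {A B : Pred J ℓ} {n} → (∀ {x} → A x → B x) → (∀ {x} → B x → A x) →
                     Enumeration A n → Enumeration B n
  enumeration-resp f g e = record
    { point = point ; injective = injective ; sound = f ∘ sound ; complete = complete ∘ g }
    where open Enumeration e

  maximal⇒enumeration : (∀ {a} → ExcludedMiddle a) → ∀ {A : Pred J ℓ} {n} →
                        Contains A n → ¬ Contains A (suc n) → Enumeration A n
  maximal⇒enumeration em {A} {n} (contains f f-inj f∈A) max = record
    { point = f ; injective = f-inj ; sound = f∈A ; complete = complete }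
    where
    complete : ∀ {x} → A x → ∃ λ k → f k ≡ x
    complete {x} x∈A with em {P = ∃ λ k → f k ≡ x}
    ... | yes p = p
    ... | no ¬p = contradiction (contains-cons x∈A (contains f f-inj f∈A) λ i eq → ¬p (i , eq)) max

-- Induction on `n`: either `g` misses `zero` and factors through the tail, or it hits `zero`
-- exactly once, and that preimage is removed along with the summand.
count-lower : ∀ {m n} (v : Fin n → ℝ⁺∞ a) (g : Fin m → Fin n) → Injective _≡_ _≡_ g →
              (∀ i → 1# ⊑ v (g i)) → fromℚ (fromℕ m) ⊑ ∑ v
count-lower {m = zero}  v g g-inj h = subst (λ q → fromℚ q ⊑ ∑ v) (sym fromℕ-zero) fromℚ-0⊑
count-lower {m = suc m} {zero}  v g g-inj h with () ← g zero
count-lower {m = suc m} {suc n} v g g-inj h with any? (λ i → g i Fin.≟ zero)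
... | no ∄ = ⊑-trans (count-lower (v ∘ suc) g′ g′-inj h′) (⊑-trans x⊑y+x (≋⇒⊒ (∑-suc v)))
  where
  0≢g : ∀ i → zero ≢ g i
  0≢g i eq = ∄ (i , sym eq)
  g′ : Fin (suc m) → Fin n
  g′ i = punchOut (0≢g i)
  g′-inj : Injective _≡_ _≡_ g′
  g′-inj {i} {j} eq = g-inj (punchOut-injective (0≢g i) (0≢g j) eq)
  h′ : ∀ i → 1# ⊑ v (suc (g′ i))
  h′ i = subst (λ k → 1# ⊑ v k) (sym (punchIn-punchOut (0≢g i))) (h i)
... | yes (i₀ , gi₀≡0) = ⊑-trans (fromℕ-suc-⊑ m)
    (⊑-trans (+-mono-hetero (subst (λ k → 1# ⊑ v k) gi₀≡0 (h i₀)) (count-lower (v ∘ suc) g′ g′-inj h′)) (≋⇒⊒ (∑-suc v)))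
  where
  +-mono-hetero : {x y : ℝ⁺∞ 0ℓ} {x′ y′ : ℝ⁺∞ a} → x ⊑ x′ → y ⊑ y′ → x ⊕ y ⊑ x′ ⊕ y′
  +-mono-hetero f g .apply p =
    let r , s , r<x , s<y , q≤ = ⊕-elim p in ⊕-intro (apply f r<x) (apply g s<y) q≤
  0≢g : ∀ j → zero ≢ g (punchIn i₀ j)
  0≢g j eq = punchInᵢ≢i i₀ j (g-inj (trans (sym eq) (sym gi₀≡0)))
  g′ : Fin m → Fin n
  g′ j = punchOut (0≢g j)
  g′-inj : Injective _≡_ _≡_ g′
  g′-inj {i} {j} eq = punchIn-injective i₀ i j (g-inj (punchOut-injective (0≢g i) (0≢g j) eq))
  h′ : ∀ j → 1# ⊑ v (suc (g′ j))
  h′ j = subst (λ k → 1# ⊑ v k) (sym (punchIn-punchOut (0≢g j))) (h (punchIn i₀ j))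

count-none : ∀ {J : Set ℓ} {A : Pred J a} {n} (f : Fin n → J) → (∀ i → ¬ A (f i)) → ∑ (𝟙 A ∘ f) ⊑ 𝟘 {a}
count-none {n = zero}  f h = ≋⇒⊒ 𝟘≋0
count-none {A = A} {n = suc n} f h = ⊑-trans (≋⇒⊑ (∑-suc (𝟙 A ∘ f)))
  (⊑-trans (+-mono (𝟙-∉ {A = A} (h zero)) (count-none {A = A} (f ∘ suc) (h ∘ suc))) 0+x⊑x)

count-unique : (∀ {a} → ExcludedMiddle a) → ∀ {J : Set ℓ} {A : Pred J a} {n} (f : Fin n → J) →
               (∀ {i j} → A (f i) → A (f j) → i ≡ j) → ∑ (𝟙 A ∘ f) ⊑ 1#
count-unique em {n = zero}  f h = ⊑-trans (≋⇒⊒ 𝟘≋0) 0⊑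
count-unique em {A = A} {n = suc n} f h with em {P = A (f zero)}
... | yes p = ⊑-trans (≋⇒⊑ (∑-suc (𝟙 A ∘ f))) (⊑-trans (+-monoʳ
    (count-none {A = A} (f ∘ suc) λ i q → contradiction (h p q) λ ()))
  (⊑-trans +-comm-⊑ (⊑-trans 0+x⊑x (𝟙⊑1 {A = A}))))
... | no ¬p = ⊑-trans (≋⇒⊑ (∑-suc (𝟙 A ∘ f))) (⊑-trans (+-monoˡ (𝟙-∉ {A = A} ¬p))
  (⊑-trans 0+x⊑x (count-unique em {A = A} (f ∘ suc) λ p q → suc-injective (h p q))))

-- Separation of points by countably many open balls

unpair : ℕ → ℕ × ℕ
unpair zero = 0 , 0
unpair (suc n) = next (unpair n)
  where
  next : ℕ × ℕ → ℕ × ℕ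
  next (zero  , m) = suc m , 0
  next (suc k , m) = k , suc m

-- `unpair` runs through the antidiagonals: `(k , suc m)` follows `(suc k , m)`, and `(suc k , 0)`
-- follows `(0 , k)`, the end of the previous antidiagonal.
unpair-surjective : ∀ k m → ∃ λ n → unpair n ≡ (k , m)
unpair-surjective k m = go (k ℕ.+ m) k m refl
  where
  go : ∀ s k m → k ℕ.+ m ≡ s → ∃ λ n → unpair n ≡ (k , m)
  go s zero zero eq = 0 , refl
  go (suc s) (suc k) zero eq with go s 0 k (ℕ.suc-injective (trans (cong suc (sym (ℕ.+-identityʳ k))) eq))
  ... | n , p = suc n , cong-next p
    where
    cong-next : unpair n ≡ (0 , k) → unpair (suc n) ≡ (suc k , 0)
    cong-next p rewrite p = refl
  go s k (suc m) eq with go s (suc k) m (trans (sym (ℕ.+-suc k m)) eq)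
  ... | n , p = suc n , cong-next p
    where
    cong-next : unpair n ≡ (suc k , m) → unpair (suc n) ≡ (k , suc m)
    cong-next p rewrite p = refl

module Separation (em : ∀ {a} → ExcludedMiddle a) {ℓ : Level} (M : MeasurableSpace ℓ) where

  open MeasurableSpace M

  -- One set has to exclude finitely many points at once, so that a point of a class can be split
  -- off from all the others still to be counted.
  Separating : (ℕ → Pred J ℓ) → Set ℓ
  Separating U = ∀ {n} x (f : Fin n → J) → (∀ i → f i ≢ x) → ∃ λ k → U k x × ∀ i → ¬ U k (f i)

  module _ (d : J → J → ℝ⁺∞ 0ℓ) (metric : IsMetric d) (s : ℕ → Maybe J)
           (dense : ∀ x r → 0ℚ ℚ.< r → ∃₂ λ n y → s n ≡ just y × d x y ≺ r) where

    open IsGeneralMetric (proj₁ metric) using (0⇒≈; triangle) renaming (sym to d-sym)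

    ball : ℚ → J → Pred J 0ℓ
    ball r p x = d x p ≺ r

    below⇒≤ : ∀ {a} (x : ℝ⁺∞ a) {q r} → q <ʳ x → ¬ r <ʳ x → q ℚ.≤ r
    below⇒≤ x q<x r≮x = ℚ.≮⇒≥ λ r<q → r≮x (downward x r<q q<x)

    ≺-trans : ∀ {a b} {x : ℝ⁺∞ a} {y : ℝ⁺∞ b} {r} → x ⊑ y → y ≺ r → x ≺ r
    ≺-trans f (q , q<r , q≮y) = q , q<r , λ p → q≮y (apply f p)

    <-≤-cancel : ∀ {u v r s} → r ℚ.+ s ℚ.≤ u ℚ.+ v → u ℚ.≤ r → v ℚ.≤ s → u ≡ r
    <-≤-cancel {u} {v} {r} {s} h u≤r v≤s with ≤⇒<∨≡ u≤r
    ... | inj₂ eq = eq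
    ... | inj₁ u<r = contradiction (ℚ.<-≤-trans (ℚ.+-mono-<-≤ u<r v≤s) h) (ℚ.<-irrefl refl)

    ≺-+ : ∀ {a} {x y : ℝ⁺∞ a} {r s} → x ≺ r → y ≺ s → (x ⊕ y) ≺ (r ℚ.+ s)
    ≺-+ {x = x} {y} (p , p<r , p≮x) (q , q<s , q≮y) = p ℚ.+ q , ℚ.+-mono-< p<r q<s , λ h →
      let u , v , u<x , v<y , ≤u+v = ⊕-elim h in
      p≮x (subst (_<ʳ x) (<-≤-cancel ≤u+v (below⇒≤ x u<x p≮x) (below⇒≤ y v<y q≮y)) u<x)

    triangle′ : ∀ x y z → d x z ⊑ d x y ⊕ d y z
    triangle′ x y z = ⊑-trans (⊑-intro (triangle x y z)) (≋⇒⊒ (⊕≋+ {x = d x y} {y = d y z}))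

    ball-open : ∀ r p → Open {ℓ = ℓ} d (λ x → Lift ℓ (ball r p x))
    ball-open r p x (lift (q , q<r , q≮d)) with ℚ.<-dense q<r
    ... | t , q<t , t<r = r ℚ.- t , p<q⇒0<q-p t<r , λ y y∈ → lift (subst (d y p ≺_)
      (trans (ℚ.+-comm (r ℚ.- t) t) (<-split t r))
      (≺-trans (triangle′ y x p) (≺-+ (≺-trans {x = d y x} {y = d x y} (⊑-intro (proj₁ (d-sym y x))) y∈) (q , q<t , q≮d))))

    balls : ℕ → Pred J ℓ
    balls n x = ∃ λ p → s (proj₁ (unpair n)) ≡ just p × ball (1/suc (proj₂ (unpair n))) p x

    balls-open : ∀ n → Open {ℓ = ℓ} d (balls n)
    balls-open n x (p , eq , x∈) =
      let r , 0<r , h = ball-open (1/suc (proj₂ (unpair n))) p x (lift x∈) in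
      r , 0<r , λ y y∈ → p , eq , Level.lower (h y y∈)

    distance>0 : ∀ {x y} → x ≢ y → ∃ λ q → 0ℚ ℚ.< q × q <ʳ d x y
    distance>0 {x} {y} x≢y with em {P = ∃ λ q → 0ℚ ℚ.< q × q <ʳ d x y}
    ... | yes p = p
    ... | no ¬p = contradiction (0⇒≈ (d⊑0 , λ (Level.lift q<0) → negative (d x y) q<0)) x≢y
      where
      d⊑0 : d x y ≤ 0# {0ℓ}
      d⊑0 {q} q<d with q ℚ.<? 0ℚ
      ... | yes q<0 = lift q<0
      ... | no q≮0 = let r , q<r , r<d = rounded (d x y) q<d in
        contradiction (r , ℚ.≤-<-trans (ℚ.≮⇒≥ q≮0) q<r , r<d) ¬p

    ball-diameter : ∀ {x y p q r} → q <ʳ d x y → r ℚ.≤ ½ ℚ.* q → ball r p x → ¬ ball r p y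
    ball-diameter {x} {y} {p} {q} {r} q<d r≤ x∈ y∈ =
      let t , t<2r , t≮ = ≺-trans (triangle′ x p y) (≺-+ x∈ (≺-trans {x = d p y} {y = d y p} (⊑-intro (proj₁ (d-sym p y))) y∈)) in
      ℚ.<-irrefl refl (ℚ.<-≤-trans (ℚ.≤-<-trans (below⇒≤ (d x y) q<d t≮) t<2r)
        (subst (r ℚ.+ r ℚ.≤_) (trans (sym (ℚ.*-distribʳ-+ q ½ ½)) (ℚ.*-identityˡ q)) (ℚ.+-mono-≤ r≤ r≤)))

    -- Half of a positive lower bound for the distances from `x` works, as two points of a ball of
    -- radius `r` are less than `2 r` apart.
    radius : ∀ {n} x (f : Fin n → J) → (∀ i → f i ≢ x) →
             ∃ λ δ → 0ℚ ℚ.< δ × ∀ {r p} → r ℚ.≤ δ → ball r p x → ∀ i → ¬ ball r p (f i)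
    radius {zero}  x f f≢x = 1ℚ , ℚ.positive⁻¹ 1ℚ , λ _ _ ()
    radius {suc n} x f f≢x =
      let δ , 0<δ , h = radius x (f ∘ suc) (f≢x ∘ suc)
          q , 0<q , q<d = distance>0 (λ eq → f≢x zero (sym eq))
          t , t≤δ , t≤½q , 0<t = lesser 0<δ (*-pos (ℚ.positive⁻¹ ½) 0<q)
      in t , 0<t , λ r≤t x∈ → λ { zero → ball-diameter q<d (ℚ.≤-trans r≤t t≤½q) x∈
                                ; (suc i) → h (ℚ.≤-trans r≤t t≤δ) x∈ i }
      where
      lesser : ∀ {u v} → 0ℚ ℚ.< u → 0ℚ ℚ.< v → ∃ λ t → t ℚ.≤ u × t ℚ.≤ v × 0ℚ ℚ.< t
      lesser {u} {v} 0<u 0<v with ℚ.≤-total u v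
      ... | inj₁ u≤v = u , ℚ.≤-refl , u≤v , 0<u
      ... | inj₂ v≤u = v , v≤u , ℚ.≤-refl , 0<v

    balls-separating : Separating balls
    balls-separating x f f≢x with radius x f f≢x
    ... | δ , 0<δ , h with archimedean 0<δ
    ... | m , 1≤ with dense x (1/suc m) (0<1/suc m)
    ... | k , p , eq , x∈ with unpair-surjective k m
    ... | n , n≡ = n , (p , trans (cong (s ∘ proj₁) n≡) eq , subst (λ m → ball (1/suc m) p x) (sym (cong proj₂ n≡)) x∈)
      , λ i (p′ , eq′ , fi∈) → h 1/m≤δ x∈ i
          (subst₂ (λ m p → ball (1/suc m) p (f i)) (cong proj₂ n≡)
            (just-injective (trans (sym eq′) (trans (cong (s ∘ proj₁) n≡) eq))) fi∈)
      where
      1/m≤δ : 1/suc m ℚ.≤ δ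
      1/m≤δ = subst₂ ℚ._≤_ (ℚ.*-identityʳ (1/suc m))
        (trans (sym (ℚ.*-assoc (1/suc m) (fromℕ (suc m)) δ))
          (trans (cong (ℚ._* δ) (trans (ℚ.*-comm (1/suc m) (fromℕ (suc m))) (fromℕ*1/suc m))) (ℚ.*-identityˡ δ)))
        (*-monoˡ-≤ (ℚ.<⇒≤ (0<1/suc m)) 1≤)

  separating-sequence : IsStandardBorel M → ∃ λ U → (∀ n → ℬ (U n)) × Separating U
  separating-sequence (d , metric , _ , (s , dense) , iff) =
      balls d metric s dense
    , (λ n → Equivalence.from (iff _) (generator (balls-open d metric s dense n)))
    , balls-separating d metric s dense

-- Events and probability

module Space (em : ∀ {a} → ExcludedMiddle a) {ℓ : Level} (Ω : StandardBorelProbabilitySpace ℓ) where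

  open StandardBorelProbabilitySpace Ω
  open Integral Ω
  open Term using (coefficient; nonNegative; support)
  open Contains

  record Event : Set (lsuc ℓ) where
    constructor event
    field
      set        : Pred J ℓ
      measurable : ℬ set

  open Event public

  infix 4 _∈_ _∉_ _⊂_
  infixl 6 _∪_ _∖_
  infixl 7 _∩_

  _∈_ _∉_ : J → Event → Set ℓ
  x ∈ A = set A x
  x ∉ A = ¬ x ∈ A

  _⊂_ : Event → Event → Set ℓ
  A ⊂ B = ∀ {x} → x ∈ A → x ∈ B

  _∈?_ : ∀ x A → Dec (x ∈ A)
  x ∈? A = em

  stable : ∀ {a} {X : Set a} → ¬ ¬ X → X
  stable = decidable-stable em

  Ω₀ ∅ : Event
  Ω₀ = event (λ _ → Unit.⊤) ℬ-full
  ∅ = event (λ _ → Empty.⊥) (ℬ-resp ((λ p → ⊥-elim (p _)) , (λ ())) (ℬ-∁ ℬ-full))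

  ∁ : Event → Event
  ∁ A = event (λ x → ¬ x ∈ A) (ℬ-∁ (measurable A))

  ⋃ ⋂ : (ℕ → Event) → Event
  ⋃ A = event (λ x → ∃ λ n → x ∈ A n) (ℬ-⋃ (measurable ∘ A))
  ⋂ A = event (λ x → ∀ n → x ∈ A n)
    (ℬ-resp ((λ p n → stable λ q → p (n , q)) , (λ p (n , q) → q (p n)))
      (ℬ-∁ (ℬ-⋃ (λ n → ℬ-∁ (measurable (A n))))))

  _,,_ : ∀ {a} {X : Set a} → X → (ℕ → X) → ℕ → X
  (x ,, f) zero    = x
  (x ,, f) (suc n) = f n

  _∪_ _∩_ _∖_ : Event → Event → Event
  A ∪ B = event (λ x → x ∈ A ⊎ x ∈ B)
    (ℬ-resp ((λ { (zero , p) → inj₁ p ; (suc _ , p) → inj₂ p }) , [ (λ p → 0 , p) , (λ p → 1 , p) ])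
      (measurable (⋃ (A ,, λ _ → B))))
  A ∩ B = event (λ x → x ∈ A × x ∈ B)
    (ℬ-resp ((λ p → p 0 , p 1) , (λ (p , q) → λ { zero → p ; (suc _) → q }))
      (measurable (⋂ (A ,, λ _ → B))))
  A ∖ B = A ∩ ∁ B

  opaque
    prob : Event → ℝ⁺∞ 0ℓ
    prob A = π (set A) (measurable A)

    prob≋π : ∀ {A} → prob A ≋ π (set A) (measurable A)
    prob≋π = ≋-refl

    prob-cong : ∀ {A B} → A ⊂ B → B ⊂ A → prob A ≋ prob B
    prob-cong {A} {B} f g = ≈⇒≋ (π-cong (measurable A) (measurable B) (f , g))

    prob-∅ : prob ∅ ⊑ 𝟘 {0ℓ}
    prob-∅ = ⊑-trans (≋⇒⊑ (≈⇒≋ (π-empty (measurable ∅)))) (≋⇒⊒ 𝟘≋0)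

    prob-Ω₀ : prob Ω₀ ≋ 𝟏
    prob-Ω₀ = ≋-trans (≈⇒≋ π-full) (≋-sym 𝟏≋1)

    prob-⋃-disjoint : ∀ A → (∀ m n {x} → ¬ m ≡ n → x ∈ A m → x ∉ A n) → prob (⋃ A) ≋ ∑ᵢ (prob ∘ A)
    prob-⋃-disjoint A disjoint =
      ≋-trans (≈⇒≋ (π-additive (measurable ∘ A) λ m n m≢n x (p , q) → disjoint m n m≢n p q))
              (≋-sym ∑ᵢ≋∑∞)

  prob-∪ : ∀ A B → (∀ {x} → x ∈ A → x ∉ B) → prob (A ∪ B) ≋ prob A ⊕ prob B
  prob-∪ A B disjoint =
    ≋-trans (prob-cong [ (λ p → 0 , p) , (λ p → 1 , p) ]
               (λ { (0 , p) → inj₁ p ; (1 , p) → inj₂ p ; (suc (suc _) , ()) }))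
    (≋-trans (prob-⋃-disjoint C C-disjoint) (∑-lub upper , lower))
    where
    C : ℕ → Event
    C = A ,, (B ,, λ _ → ∅)
    C-disjoint : ∀ m n {x} → ¬ m ≡ n → x ∈ C m → x ∉ C n
    C-disjoint 0 0 m≢n p q = m≢n refl
    C-disjoint 0 1 m≢n p q = disjoint p q
    C-disjoint 1 0 m≢n p q = disjoint q p
    C-disjoint 1 1 m≢n p q = m≢n refl
    C-disjoint 0 (suc (suc _)) m≢n p ()
    C-disjoint 1 (suc (suc _)) m≢n p ()
    C-disjoint (suc (suc _)) _ m≢n ()
    zeros : ∀ n → ∑< n (λ _ → prob ∅) ⊑ 𝟘 {0ℓ}
    zeros n = ⊑-trans (∑<⊑∑ᵢ n) (∑⊑0 λ _ → prob-∅)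
    upper : ∀ n → ∑< n (prob ∘ C) ⊑ prob A ⊕ prob B
    upper zero          = 0⊑
    upper (suc zero)    = +-monoʳ 0⊑
    upper (suc (suc n)) = +-monoʳ (x+y⊑x (zeros n))
    lower : prob A ⊕ prob B ⊑ ∑ᵢ (prob ∘ C)
    lower = ⊑-trans (+-monoʳ x⊑x+y) (∑<⊑∑ᵢ 2)

  prob-split : ∀ A B → prob A ≋ prob (A ∩ B) ⊕ prob (A ∖ B)
  prob-split A B = ≋-trans
    (prob-cong (λ {x} p → split-by p (x ∈? B)) [ proj₁ , proj₁ ])
    (prob-∪ (A ∩ B) (A ∖ B) λ (_ , p) (_ , q) → q p)
    where
    split-by : ∀ {x} → x ∈ A → Dec (x ∈ B) → x ∈ (A ∩ B) ∪ (A ∖ B)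
    split-by p (yes q) = inj₁ (p , q)
    split-by p (no q)  = inj₂ (p , q)

  prob-mono : ∀ {A B} → A ⊂ B → prob A ⊑ prob B
  prob-mono {A} {B} f = ⊑-trans (≋⇒⊑ (prob-cong (λ p → f p , p) proj₂))
    (⊑-trans x⊑x+y (≋⇒⊒ (prob-split B A)))

  prob⊑1 : ∀ {A} → prob A ⊑ 𝟏
  prob⊑1 = ⊑-trans (prob-mono _) (≋⇒⊑ prob-Ω₀)

  prob-empty : ∀ {A} → (∀ {x} → x ∉ A) → prob A ⊑ 𝟘 {0ℓ}
  prob-empty f = ⊑-trans (prob-mono (λ p → ⊥-elim (f p))) prob-∅

  initial : (ℕ → Event) → ℕ → Event
  initial A zero    = ∅
  initial A (suc n) = initial A n ∪ A n

  first : (ℕ → Event) → ℕ → Event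
  first A n = A n ∖ initial A n

  ∈-initial : ∀ A {m n x} → m ℕ.< n → x ∈ A m → x ∈ initial A n
  ∈-initial A {m} {suc n} (ℕ.s≤s m≤n) p with ℕ.m≤n⇒m<n∨m≡n m≤n
  ... | inj₁ m<n  = inj₁ (∈-initial A m<n p)
  ... | inj₂ refl = inj₂ p

  initial⇒first : ∀ A n {x} → x ∈ initial A n → ∃ λ k → x ∈ first A k
  initial⇒first A (suc n) {x} p with x ∈? initial A n
  initial⇒first A (suc n) p        | yes q = initial⇒first A n q
  initial⇒first A (suc n) (inj₁ p) | no ¬q = contradiction p ¬q
  initial⇒first A (suc n) (inj₂ p) | no ¬q = n , p , ¬q

  initial⊂ : ∀ {A B} n → (∀ m → m ℕ.< n → A m ⊂ B) → initial A n ⊂ B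
  initial⊂ {A} {B} (suc n) f (inj₁ p) = initial⊂ {A} {B} n (λ m m<n → f m (ℕ.m≤n⇒m≤1+n m<n)) p
  initial⊂ {A} {B} (suc n) f (inj₂ p) = f n ℕ.≤-refl p

  prob-⋃-first : ∀ A → prob (⋃ A) ≋ ∑ᵢ (prob ∘ first A)
  prob-⋃-first A = ≋-trans
    (prob-cong (λ (n , p) → initial⇒first A (suc n) (inj₂ p)) (λ (n , p , _) → n , p))
    (prob-⋃-disjoint (first A) disjoint)
    where
    disjoint : ∀ m n {x} → ¬ m ≡ n → x ∈ first A m → x ∉ first A n
    disjoint m n m≢n (p , p′) (q , q′) with ℕ.<-cmp m n
    ... | tri< m<n _ _ = q′ (∈-initial A m<n p)
    ... | tri≈ _ m≡n _ = m≢n m≡n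
    ... | tri> _ _ n<m = p′ (∈-initial A n<m q)

  prob-initial : ∀ A n → ∑< n (prob ∘ first A) ⊑ prob (initial A n)
  prob-initial A zero    = 0⊑
  prob-initial A (suc n) = ⊑-trans (≋⇒⊑ (∑<-snoc n))
    (⊑-trans (+-monoˡ (prob-initial A n))
    (⊑-trans (≋⇒⊒ (prob-∪ (initial A n) (first A n) λ p (_ , q) → q p))
             (prob-mono λ { (inj₁ p) → inj₁ p ; (inj₂ p) → inj₂ (proj₁ p) })))

  -- Continuity of the measure from below in terms of cuts: after making the sets disjoint, the
  -- measure of the union is a series, and `q` lies below one of its partial sums.
  prob-⋃-elim : ∀ A {q} → q <ʳ prob (⋃ A) → ∃ λ n → q <ʳ prob (initial A n)
  prob-⋃-elim A p = let n , q< = ∑ᵢ-elim (apply (≋⇒⊑ (prob-⋃-first A)) p) in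
    n , apply (prob-initial A n) q<

  prob-⋃-⊑ : ∀ A → prob (⋃ A) ⊑ ∑ᵢ (prob ∘ A)
  prob-⋃-⊑ A = ⊑-trans (≋⇒⊑ (prob-⋃-first A)) (∑-mono λ n → prob-mono proj₁)

  prob-subadditive : ∀ {B} A → (∀ {x} → x ∈ B → ∃ λ n → x ∈ A n) → prob B ⊑ ∑ᵢ (prob ∘ A)
  prob-subadditive A f = ⊑-trans (prob-mono f) (prob-⋃-⊑ A)

  prob-disjoint : ∀ {B} A → (∀ m n {x} → ¬ m ≡ n → x ∈ A m → x ∉ A n) → (∀ n → A n ⊂ B) →
                  ∑ᵢ (prob ∘ A) ⊑ prob B
  prob-disjoint A d f = ⊑-trans (≋⇒⊒ (prob-⋃-disjoint A d)) (prob-mono λ (n , p) → f n p)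

  -- Integration

  toEvent : Term → Event
  toEvent t = event (support t) (Term.measurable t)

  ∫ : Simple → Event → ℝ⁺∞ 0ℓ
  ∫ []      A = 𝟘
  ∫ (t ∷ s) A = coefficient t ⊙ prob (toEvent t ∩ A) ⊕ ∫ s A

  E-simple⊑∫ : ∀ s → E-simple s ⊑ ∫ s Ω₀
  E-simple⊑∫ []      = ≋⇒⊒ 𝟘≋0
  E-simple⊑∫ (t ∷ s) = ⊑-trans (≋⇒⊒ (⊕≋+ {x = coefficient t · π (support t) (Term.measurable t)} {y = E-simple s}))
    (+-mono (⊑-trans (≋⇒⊒ (⊙≋· {x = π (support t) (Term.measurable t)}))
        (·-mono (⊑-trans (≋⇒⊒ (prob≋π {toEvent t})) (prob-mono (λ p → p , _)))))
      (E-simple⊑∫ s))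

  open CommutativeMonoid (+-commutativeMonoid 0ℓ) using (commutativeSemigroup)
  open CommutativeSemigroup commutativeSemigroup using (interchange)

  ∫-split : ∀ s A B → ∫ s A ⊑ ∫ s (A ∩ B) ⊕ ∫ s (A ∖ B)
  ∫-split []      A B = x⊑0+x
  ∫-split (t ∷ s) A B = ⊑-trans (+-mono
      (⊑-trans (·-mono (⊑-trans (≋⇒⊑ (prob-split (toEvent t ∩ A) B))
          (+-mono (prob-mono λ ((p , q) , r) → p , q , r) (prob-mono λ ((p , q) , r) → p , q , r))))
        (·-distribˡ-⊑ (nonNegative t)))
      (∫-split s A B))
    (≋⇒⊑ (interchange _ _ _ _))

  ∫-⋃ : ∀ s A → ∫ s (⋃ A) ⊑ ∑ᵢ (λ n → ∫ s (A n))
  ∫-⋃ []      A = 0⊑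
  ∫-⋃ (t ∷ s) A = ⊑-trans (+-mono
      (⊑-trans (·-mono (prob-subadditive (λ n → toEvent t ∩ A n) λ (p , n , q) → n , p , q))
        (∑-·-⊑ (nonNegative t)))
      (∫-⋃ s A))
    ∑-+-⊒

  value-tail : ∀ t s x → value s x ⊑ value (t ∷ s) x
  value-tail t s x .apply {q} q< =
    let r , q<r , r< = rounded (value s x) q< in
    q ℚ.- r , r , inj₁ (p<q⇒p-q<0 q<r) , r< ,
    ℚ.≤-reflexive (sym (trans (ℚ.+-comm (q ℚ.- r) r) (<-split r q)))

  <-term : ∀ t {x q} → support t x → q ℚ.< coefficient t → q <ʳ coefficient t · 𝟙 (support t) x
  <-term t {x} {q} x∈t q<c = apply (≋⇒⊑ ⊙≋·) (⊙-intro x∈t q<c)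
    where
    ⊙-intro : support t x → q ℚ.< coefficient t → q <ʳ coefficient t ⊙ 𝟙 (support t) x
    ⊙-intro x∈t q<c with q ℚ.<? 0ℚ
    ... | yes q<0 = negative (coefficient t ⊙ 𝟙 (support t) x) q<0
    ... | no q≮0 =
      let r , q<r , r<c = ℚ.<-dense q<c
          0<c = ℚ.≤-<-trans (ℚ.≮⇒≥ q≮0) q<c
          d , 0<d , cd≡1 = reciprocal 0<c
      in ·-intro 0<c (inj₂ (x∈t , inj₂ (subst (d ℚ.* r ℚ.<_) (trans (ℚ.*-comm d _) cd≡1) (*-monoˡ-< 0<d r<c))))
           (ℚ.≤-trans (ℚ.<⇒≤ q<r) (ℚ.≤-reflexive (sym (trans (sym (ℚ.*-assoc (coefficient t) d r))
              (trans (cong (ℚ._* r) cd≡1) (ℚ.*-identityˡ r))))))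

  value-∈ : ∀ t s {x c} → support t x → value (t ∷ s) x ⊑ fromℚ c → value s x ⊑ fromℚ (c ℚ.- coefficient t)
  value-∈ t s {x} {c} x∈t f .apply {q} q< =
    let r , q<r , r< = rounded (value s x) q< in
    Sum.map (ℚ.≤-<-trans (subst (ℚ._≤ d ℚ.+ q) (ℚ.+-identityˡ q) (ℚ.+-monoˡ-≤ q (nonNegative t))))
      (λ p → subst (ℚ._< c ℚ.- d) (cancel d q) (ℚ.+-monoˡ-< (ℚ.- d) p))
   
    -- `<-term` needs a rational strictly below `d`; the slack `r - q` is made up by `r`, which is
    -- still below `value s x` by roundedness.
    (apply f (d ℚ.- (r ℚ.- q) , r , <-term t x∈t (lt q<r) , r< , ℚ.≤-reflexive (eq d q r)))
    where
    d = coefficient t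
    open +-*-Solver
    eq : ∀ d q r → d ℚ.+ q ≡ d ℚ.- (r ℚ.- q) ℚ.+ r
    eq = solve 3 (λ d q r → d :+ q := d :- (r :- q) :+ r) refl
    cancel : ∀ d q → d ℚ.+ q ℚ.- d ≡ q
    cancel = solve 2 (λ d q → d :+ q :- d := q) refl
    lt : ∀ {q r} → q ℚ.< r → d ℚ.- (r ℚ.- q) ℚ.< d
    lt {q} {r} q<r = subst (d ℚ.- (r ℚ.- q) ℚ.<_) (ℚ.+-identityʳ d)
      (ℚ.+-monoʳ-< d (ℚ.neg-antimono-< (p<q⇒0<q-p q<r)))

  coefficient≤ : ∀ t s {x c} → 0ℚ ℚ.≤ c → support t x → value (t ∷ s) x ⊑ fromℚ c → coefficient t ℚ.≤ c
  coefficient≤ t s {x} {c} 0≤c x∈t f = ℚ.≮⇒≥ λ c<d →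
    let r , c<r , r<d = ℚ.<-dense c<d in
    [ (λ c<0 → ℚ.<-irrefl refl (ℚ.<-≤-trans c<0 0≤c)) , ℚ.<-irrefl refl ]
    (apply f (r , c ℚ.- r , <-term t x∈t r<d , negative (value s x) (p<q⇒p-q<0 c<r) ,
      ℚ.≤-reflexive (sym (<-split r c))))

  -- The supports of a simple function may overlap, so it is not brought into a normal form. Instead
  -- `A` is split along the support of the first term: there the remaining terms are bounded by `c`
  -- minus its coefficient, elsewhere still by `c`. If the coefficient exceeds `c`, the support
  -- misses `A`.
  ∫-bound : ∀ s A {c} → 0ℚ ℚ.≤ c → (∀ {x} → x ∈ A → value s x ⊑ fromℚ c) → ∫ s A ⊑ c ⊙ prob A
  ∫-bound []      A 0≤c f = 0⊑
  ∫-bound (t ∷ s) A {c} 0≤c f with coefficient t ℚ.≤? c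
  ... | no d≰c = ⊑-trans (+-mono
      (⊑-trans (·-mono (prob-empty λ (p , q) → d≰c (coefficient≤ t s 0≤c p (f q)))) (r·0⊑0 (nonNegative t)))
      (∫-bound s A 0≤c λ p → ⊑-trans (value-tail t s _) (f p)))
    0+x⊑x
  ... | yes d≤c = ⊑-trans (+-mono (·-mono (prob-mono λ (p , q) → q , p)) (∫-split s A (toEvent t)))
    (⊑-trans (+-monoʳ (+-mono
      (∫-bound s (A ∩ toEvent t) (p≤q⇒0≤q-p d≤c) λ (p , q) → value-∈ t s q (f p))
      (∫-bound s (A ∖ toEvent t) 0≤c λ (p , q) → ⊑-trans (value-tail t s _) (f p))))
    (⊑-trans +-assoc-⊒
    (⊑-trans (+-monoˡ (·-distribʳ-⊒ (nonNegative t) (p≤q⇒0≤q-p d≤c)))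
    (⊑-trans (+-monoˡ (subst (λ e → (coefficient t ℚ.+ (c ℚ.- coefficient t)) ⊙ prob (A ∩ toEvent t) ⊑ e ⊙ prob (A ∩ toEvent t))
        (<-split (coefficient t) c) ⊑-refl))
    (⊑-trans (·-distribˡ-⊒ 0≤c) (·-mono (≋⇒⊒ (prob-split A (toEvent t)))))))))

  ∫-mono : ∀ s {A B} → A ⊂ B → ∫ s A ⊑ ∫ s B
  ∫-mono []      f = ⊑-refl
  ∫-mono (t ∷ s) f = +-mono (·-mono (prob-mono λ (p , q) → p , f q)) (∫-mono s f)

  E-simple⊑∫-support : ∀ s {B} → (∀ {x} → x ∉ B → value s x ⊑ fromℚ 0ℚ) → E-simple s ⊑ ∫ s B
  E-simple⊑∫-support s {B} h = ⊑-trans (E-simple⊑∫ s) (⊑-trans (∫-split s Ω₀ B)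
    (⊑-trans (+-mono (∫-mono s proj₂)
        (⊑-trans (∫-bound s (Ω₀ ∖ B) ℚ.≤-refl λ (_ , p) → h p) 0·x⊑0))
      (⊑-trans +-comm-⊑ 0+x⊑x)))

  ⨆-lub : ∀ {a b i} {I : Set i} (x : I → ℝ⁺∞ a) {y : ℝ⁺∞ b} → (∀ j → x j ⊑ y) → ⨆ I x ⊑ y
  ⨆-lub x {y} f .apply (inj₁ q<0)      = negative y q<0
  ⨆-lub x     f .apply (inj₂ (j , q<)) = apply (f j) q<

  ⨆-upper : ∀ {a i} {I : Set i} (x : I → ℝ⁺∞ a) j → x j ⊑ ⨆ I x
  ⨆-upper x j .apply q< = inj₂ (j , q<)

  E-lub : ∀ f {b} {y : ℝ⁺∞ b} → (∀ s → (∀ x → value s x ⊑ f x) → E-simple s ⊑ y) → E f ⊑ y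
  E-lub f h = ⨆-lub (λ (s , _) → E-simple s) λ (s , s≤f) → h s λ x → ⊑-intro (s≤f x)

  E-upper : ∀ f s → (∀ x → value s x ⊑ f x) → E-simple s ⊑ E f
  E-upper f s h .apply q< = inj₂ ((s , λ x → apply (h x)) , q<)

  E-⊑-∑ : ∀ f (A : ℕ → Event) (c : ℕ → ℚ) → (∀ n → 0ℚ ℚ.≤ c n) →
          (∀ n {x} → x ∈ A n → f x ⊑ fromℚ (c n)) →
          (∀ {x} → (∀ n → x ∉ A n) → f x ⊑ fromℚ 0ℚ) →
          E f ⊑ ∑ᵢ (λ n → c n ⊙ prob (A n))
  E-⊑-∑ f A c 0≤c h h₀ = E-lub f λ s s≤f → ⊑-trans
    (E-simple⊑∫-support s {⋃ A} λ p → ⊑-trans (s≤f _) (h₀ λ n q → p (n , q)))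
    (⊑-trans (∫-⋃ s A) (∑-mono λ n → ∫-bound s (A n) (0≤c n) λ p → ⊑-trans (s≤f _) (h n p)))

  E-⊑-· : ∀ f A {c} → 0ℚ ℚ.≤ c → (∀ {x} → x ∈ A → f x ⊑ fromℚ c) →
          (∀ {x} → x ∉ A → f x ⊑ fromℚ 0ℚ) → E f ⊑ c ⊙ prob A
  E-⊑-· f A 0≤c h h₀ = E-lub f λ s s≤f → ⊑-trans
    (E-simple⊑∫-support s λ p → ⊑-trans (s≤f _) (h₀ p))
    (∫-bound s A 0≤c λ p → ⊑-trans (s≤f _) (h p))

  open Separation em measurableSpace using (Separating; separating-sequence)

  private
    separating : ∃ λ U → (∀ n → ℬ (U n)) × Separating U
    separating = separating-sequence isStandardBorel

  U : ℕ → Event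
  U n = event (proj₁ separating n) (proj₁ (proj₂ separating) n)

  U-separates : ∀ {n} x (f : Fin n → J) → (∀ i → f i ≢ x) → ∃ λ k → x ∈ U k × ∀ i → f i ∉ U k
  U-separates = proj₂ (proj₂ separating)

  U-separates₁ : ∀ {x y} → x ≢ y → ∃ λ k → x ∈ U k × y ∉ U k
  U-separates₁ {x} {y} x≢y =
    let k , x∈ , y∉ = U-separates {1} x (λ _ → y) (λ _ eq → x≢y (sym eq)) in k , x∈ , y∉ zero

  -- Simple functions with disjoint supports, for lower bounds on expectations

  terms : ℕ → (ℕ → Term) → Simple
  terms zero    t = []
  terms (suc n) t = t 0 ∷ terms n (t ∘ suc)

  value-∷ : ∀ t s x → value (t ∷ s) x ≋ coefficient t ⊙ 𝟙 (support t) x ⊕ value s x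
  value-∷ t s x = ≋-sym (≋-trans (⊕≋+ {x = coefficient t ⊙ 𝟙 (support t) x} {y = value s x}) +-congˡ)
    where
    +-congˡ : coefficient t ⊙ 𝟙 (support t) x + value s x ≋ coefficient t · 𝟙 (support t) x + value s x
    +-congˡ = ⊑-intro (λ (r , s , r< , s< , q≤) → r , s , apply (≋⇒⊑ ⊙≋·) r< , s< , q≤)
            , ⊑-intro (λ (r , s , r< , s< , q≤) → r , s , apply (≋⇒⊒ ⊙≋·) r< , s< , q≤)

  value-∌ : ∀ t s x {y : ℝ⁺∞ ℓ} → ¬ support t x → value s x ⊑ y → value (t ∷ s) x ⊑ y
  value-∌ t s x x∉t h = ⊑-trans (≋⇒⊑ (value-∷ t s x)) (⊑-trans
    (+-mono (⊑-trans (·-mono (𝟙-∉ {A = support t} x∉t)) (r·0⊑0 (nonNegative t))) h) 0+x⊑x)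

  value-∋ : ∀ t s x → value s x ⊑ 𝟘 {ℓ} → value (t ∷ s) x ⊑ fromℚ (coefficient t)
  value-∋ t s x h = ⊑-trans (≋⇒⊑ (value-∷ t s x)) (⊑-trans
    (+-monoʳ h) (⊑-trans +-comm-⊑ (⊑-trans 0+x⊑x (·⊑fromℚ (nonNegative t) (𝟙⊑1 {A = support t})))))

  value-terms-0 : ∀ n t x → (∀ i → ¬ support (t i) x) → value (terms n t) x ⊑ 𝟘 {ℓ}
  value-terms-0 zero    t x h = ≋⇒⊒ 𝟘≋0
  value-terms-0 (suc n) t x h = value-∌ (t 0) (terms n (t ∘ suc)) x (h 0) (value-terms-0 n (t ∘ suc) x (h ∘ suc))

  value-terms : ∀ n t x {y : ℝ⁺∞ ℓ} → (∀ {i j} → support (t i) x → support (t j) x → i ≡ j) →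
                (∀ i → support (t i) x → fromℚ (coefficient (t i)) ⊑ y) → value (terms n t) x ⊑ y
  value-terms zero    t x d h = ⊑-trans (≋⇒⊒ 𝟘≋0) 0⊑
  value-terms (suc n) t x d h with em {P = support (t 0) x}
  ... | no ¬p = value-∌ (t 0) (terms n (t ∘ suc)) x ¬p
    (value-terms n (t ∘ suc) x (λ p q → ℕ.suc-injective (d p q)) (h ∘ suc))
  ... | yes p = ⊑-trans (value-∋ (t 0) (terms n (t ∘ suc)) x
      (value-terms-0 n (t ∘ suc) x λ i q → contradiction (d p q) λ ())) (h 0 p)

  E-simple-∷ : ∀ t s → E-simple (t ∷ s) ≋ coefficient t ⊙ prob (toEvent t) ⊕ E-simple s
  E-simple-∷ t s = ≋-sym (≋-trans (⊕≋+ {x = coefficient t ⊙ prob (toEvent t)} {y = E-simple s}) +-congˡ)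
    where
    term-cong : coefficient t ⊙ prob (toEvent t) ≋ coefficient t · π (support t) (measurable (toEvent t))
    term-cong = ≋-trans (·-mono (≋⇒⊑ (prob≋π {toEvent t})) , ·-mono (≋⇒⊒ (prob≋π {toEvent t}))) ⊙≋·
    +-congˡ : coefficient t ⊙ prob (toEvent t) + E-simple s ≋ coefficient t · π (support t) (measurable (toEvent t)) + E-simple s
    +-congˡ = ⊑-intro (λ (r , s , r< , s< , q≤) → r , s , apply (≋⇒⊑ term-cong) r< , s< , q≤)
            , ⊑-intro (λ (r , s , r< , s< , q≤) → r , s , apply (≋⇒⊒ term-cong) r< , s< , q≤)

  E-simple-terms : ∀ n t → ∑< n (λ i → coefficient (t i) ⊙ prob (toEvent (t i))) ⊑ E-simple (terms n t)
  E-simple-terms zero    t = 0⊑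
  E-simple-terms (suc n) t = ⊑-trans (+-monoʳ (E-simple-terms n (t ∘ suc)))
    (≋⇒⊒ (E-simple-∷ (t 0) (terms n (t ∘ suc))))

  -- Class sizes

  module Class (P : BPartition measurableSpace) where

    open BPartition P public using (partition; class; ∼-refl; ∼-sym; ∼-trans) renaming (_∼_ to infix 4 _∼_)

    sat : Event → Event
    sat A = event (Partition.saturation partition (set A)) (BPartition.ℬ-saturation P (measurable A))

    ∈-sat : ∀ {A x} → x ∈ A → x ∈ sat A
    ∈-sat {x = x} x∈A = x , ∼-refl , x∈A

    sat-∼ : ∀ {A x y} → x ∼ y → x ∈ sat A → y ∈ sat A
    sat-∼ x∼y (z , x∼z , z∈A) = z , ∼-trans (∼-sym x∼y) x∼z , z∈A

    sat-sat : ∀ {A B} → A ⊂ sat B → sat A ⊂ sat B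
    sat-sat {B = B} f (z , x∼z , z∈A) = sat-∼ {A = B} (∼-sym x∼z) (f z∈A)

    -- A point of the class can be split off from finitely many others by some U n.
    atLeast : Event → ℕ → Event
    atLeast A zero    = Ω₀
    atLeast A (suc k) = ⋃ λ n → sat (A ∩ U n) ∩ atLeast (A ∖ U n) k

    atLeast⇒contains : ∀ A k {x} → x ∈ atLeast A k → Contains (λ y → x ∼ y × y ∈ A) k
    atLeast⇒contains A zero    _ = contains (λ ()) (λ {}) λ ()
    atLeast⇒contains A (suc k) (n , (y , x∼y , y∈A , y∈U) , p) =
      let h = atLeast⇒contains (A ∖ U n) k p in
      contains-cons (x∼y , y∈A) (contains-⊆ (λ (x∼z , z∈A , _) → x∼z , z∈A) h)
        λ i eq → proj₂ (proj₂ (inside h i)) (subst (_∈ U n) (sym eq) y∈U)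

    contains⇒atLeast : ∀ A k {x} → Contains (λ y → x ∼ y × y ∈ A) k → x ∈ atLeast A k
    contains⇒atLeast A zero    _ = _
    contains⇒atLeast A (suc k) (contains f f-inj h) =
      let n , f₀∈U , f₊∉U = U-separates (f zero) (f ∘ suc) (λ i eq → contradiction (f-inj eq) λ ()) in
      n , (f zero , proj₁ (h zero) , proj₂ (h zero) , f₀∈U) ,
      contains⇒atLeast (A ∖ U n) k (contains (f ∘ suc) (λ eq → suc-injective (f-inj eq))
        λ i → proj₁ (h (suc i)) , proj₂ (h (suc i)) , f₊∉U i)

    -- The points whose class has k + 1 elements.
    ofSize : ℕ → Event
    ofSize k = atLeast Ω₀ (suc k) ∖ atLeast Ω₀ (suc (suc k))

    ofSize⇒enumeration : ∀ k {x} → x ∈ ofSize k → Enumeration (class x) (suc k)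
    ofSize⇒enumeration k (p , ¬q) = maximal⇒enumeration em
      (contains-⊆ proj₁ (atLeast⇒contains Ω₀ (suc k) p))
      (λ q → ¬q (contains⇒atLeast Ω₀ (suc (suc k)) (contains-⊆ (λ x∼y → x∼y , _) q)))

    enumeration⇒ofSize : ∀ k {x} → Enumeration (class x) (suc k) → x ∈ ofSize k
    enumeration⇒ofSize k e =
        contains⇒atLeast Ω₀ (suc k) (contains-⊆ (λ x∼y → x∼y , _) (enumeration⇒contains e))
      , λ p → ℕ.<-irrefl refl (contains⇒≤ e (contains-⊆ proj₁ (atLeast⇒contains Ω₀ (suc (suc k)) p)))

    ofSize-unique : ∀ k m {x} → x ∈ ofSize k → x ∈ ofSize m → k ≡ m
    ofSize-unique k m p q =
      ℕ.suc-injective (enumeration-unique (ofSize⇒enumeration k p) (ofSize⇒enumeration m q))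

    ofSize-∼ : ∀ k {x y} → x ∼ y → x ∈ ofSize k → y ∈ ofSize k
    ofSize-∼ k x∼y p = enumeration⇒ofSize k
      (enumeration-resp (∼-trans (∼-sym x∼y)) (∼-trans x∼y) (ofSize⇒enumeration k p))

    finite infinite : Event
    finite = ⋃ ofSize
    infinite = ∁ finite

    finite-∼ : ∀ {x y} → x ∼ y → x ∈ finite → y ∈ finite
    finite-∼ x∼y (k , p) = k , ofSize-∼ k x∼y p

    -- The integral of 1/|𝒫ₓ| over A.
    I : Event → ℝ⁺∞ 0ℓ
    I A = ∑ᵢ λ k → 1/suc k ⊙ prob (A ∩ ofSize k)

    0≤1/suc : ∀ k → 0ℚ ℚ.≤ 1/suc k
    0≤1/suc k = ℚ.<⇒≤ (0<1/suc k)

    size⁻¹ : J → ℝ⁺∞ ℓ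
    size⁻¹ x = 1/∣ class x ∣

    ofSize⇒size⁻¹ : ∀ k {x} → x ∈ ofSize k → size⁻¹ x ≋ fromℚ (1/suc k)
    ofSize⇒size⁻¹ k {x} p = subst (λ r → size⁻¹ x ≋ fromℚ r) (sym (1/suc-def k))
      ( ⨆-lub family (λ (m , e) → family-cong (ofSize-unique k m p (enumeration⇒ofSize m e)))
      , ⨆-upper family (k , ofSize⇒enumeration k p))
      where
      family : FiniteNonEmpty (class x) → ℝ⁺∞ 0ℓ
      family (m , _) = fromℚ (ℤ.+ 1 ℚ./ suc m)
      family-cong : ∀ {m k} → k ≡ m → fromℚ (ℤ.+ 1 ℚ./ suc m) ⊑ fromℚ (ℤ.+ 1 ℚ./ suc k)
      family-cong refl = ⊑-refl

    infinite⇒size⁻¹ : ∀ {x} → (∀ k → x ∉ ofSize k) → size⁻¹ x ⊑ fromℚ 0ℚ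
    infinite⇒size⁻¹ h = ⨆-lub (λ (m , _) → fromℚ (ℤ.+ 1 ℚ./ suc m))
      (λ (m , e) → contradiction (enumeration⇒ofSize m e) (h m))

    -- With `I⊑ψ` this replaces the supremum over simple functions by a series over class sizes,
    -- available because the level sets `ofSize k` are measurable. The combinatorial part of the
    -- proof deals with `I` only.
    ψ⊑I : ψ Ω P ⊑ I Ω₀
    ψ⊑I = E-⊑-∑ size⁻¹ (λ k → Ω₀ ∩ ofSize k) 1/suc 0≤1/suc
      (λ k (_ , p) → ≋⇒⊑ (ofSize⇒size⁻¹ k p)) (λ h → infinite⇒size⁻¹ λ k p → h k (_ , p))

    I⊑ψ : I Ω₀ ⊑ ψ Ω P
    I⊑ψ = ∑-lub λ n → ⊑-trans (E-simple-terms n t) (E-upper size⁻¹ (terms n t) λ x →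
      value-terms n t x (λ {i} {j} (_ , p) (_ , q) → ofSize-unique i j p q)
        λ i (_ , p) → ≋⇒⊒ (ofSize⇒size⁻¹ i p))
      where
      t : ℕ → Term
      t k = record { coefficient = 1/suc k ; nonNegative = 0≤1/suc k
                   ; support = set (Ω₀ ∩ ofSize k) ; measurable = measurable (Ω₀ ∩ ofSize k) }

    I-⊕ : ∀ A B {C} → (∀ {x} → x ∈ A → x ∉ B) → A ⊂ C → B ⊂ C → I A ⊕ I B ⊑ I C
    I-⊕ A B {C} d A⊂C B⊂C = ⊑-trans ∑-+-⊒ (∑-mono λ k → ⊑-trans (·-distribˡ-⊒ (0≤1/suc k))
      (·-mono (⊑-trans (≋⇒⊒ (prob-∪ (A ∩ ofSize k) (B ∩ ofSize k) λ (p , _) (q , _) → d p q))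
        (prob-mono λ { (inj₁ (p , q)) → A⊂C p , q ; (inj₂ (p , q)) → B⊂C p , q }))))

    I-subadditive : ∀ {B} A → (∀ {x} → x ∈ B → x ∈ finite → ∃ λ n → x ∈ A n) → I B ⊑ ∑ᵢ (I ∘ A)
    I-subadditive A h = ⊑-trans (∑-mono λ k → ⊑-trans
        (·-mono (prob-subadditive (λ n → A n ∩ ofSize k) λ (p , q) →
          let n , r = h p (k , q) in n , r , q))
        (∑-·-⊑ (0≤1/suc k)))
      ∑-comm-⊑

    -- Comparing a set with its saturation by re-randomizing

    module _ (re-randomizing : ReRandomizing Ω P) where

      μ-family : ∀ x A → FiniteNonEmpty (class x) ⊎ ¬ FiniteNonEmpty (class x) → ℝ⁺∞ ℓ
      μ-family x A =
        [ (λ (k , e) → (ℤ.+ 1 ℚ./ suc k) · ∑ (𝟙 (set A) ∘ Enumeration.point e)) , (λ _ → 𝟙 (set A) x) ]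

      average : ∀ {x k} A → Enumeration (class x) (suc k) → ℝ⁺∞ ℓ
      average {k = k} A e = 1/suc k ⊙ ∑ (𝟙 (set A) ∘ Enumeration.point e)

      μ-finite : ∀ {x k} A (e : Enumeration (class x) (suc k)) → average A e ≋ μ-family x A (inj₁ (k , e))
      μ-finite {x} {k} A e = ≋-trans ⊙≋· (subst (λ r → 1/suc k · y ≋ r · y) (1/suc-def k) ≋-refl)
        where
        y : ℝ⁺∞ ℓ
        y = ∑ (𝟙 (set A) ∘ Enumeration.point e)

      -- For `x` in `sat A` the class has `k + 1` points, at least `m + 1` of them in `A`, so `μ`
      -- gives `A` at least the proportion `ratio`. Integrating this over `sat A` gives at most
      -- `prob A`.
      ofSize-prob-lower : ∀ k m {A} → A ⊂ ofSize k →
        (∀ {x} → x ∈ sat A → Contains (λ y → x ∼ y × y ∈ A) (suc m)) →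
        1/suc k ⊙ prob (sat A) ⊑ 1/suc m ⊙ prob A
      ofSize-prob-lower k m {A} A⊂k h = ⊑-trans (subst (λ r → 1/suc k ⊙ prob (sat A) ⊑ r ⊙ prob (sat A)) eq ⊑-refl)
        (⊑-trans (≋⇒⊒ (·-assoc (0<1/suc m) 0<ratio)) (·-mono lower))
        where
        ratio = 1/suc k ℚ.* fromℕ (suc m)
        0<ratio : 0ℚ ℚ.< ratio
        0<ratio = *-pos (0<1/suc k) (0<fromℕ m)
        eq : 1/suc k ≡ 1/suc m ℚ.* ratio
        eq = sym (trans (cong (1/suc m ℚ.*_) (ℚ.*-comm (1/suc k) (fromℕ (suc m))))
          (trans (sym (ℚ.*-assoc (1/suc m) (fromℕ (suc m)) (1/suc k)))
          (trans (cong (ℚ._* 1/suc k) (trans (ℚ.*-comm (1/suc m) (fromℕ (suc m))) (fromℕ*1/suc m)))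
                 (ℚ.*-identityˡ (1/suc k)))))
        t : Term
        t = record { coefficient = ratio ; nonNegative = ℚ.<⇒≤ 0<ratio
                   ; support = set (sat A) ; measurable = measurable (sat A) }
        bound : ∀ x → value (t ∷ []) x ⊑ μ partition x (set A)
        bound x with x ∈? sat A
        ... | no x∉ = value-∌ t [] x x∉ (⊑-trans (≋⇒⊒ 𝟘≋0) 0⊑)
        ... | yes x∈@(y , x∼y , y∈A) = ⊑-trans (value-∋ t [] x (≋⇒⊒ 𝟘≋0))
            (⊑-trans (fromℚ-· (0<1/suc k) (count-lower (𝟙 (set A) ∘ Enumeration.point e) index index-inj
               λ i → 𝟙-∈ {A = set A} (subst (_∈ A) (sym (index-point i)) (proj₂ (inside (h x∈) i)))))
            (⊑-trans (≋⇒⊑ (μ-finite A e)) (⨆-upper (μ-family x A) (inj₁ (k , e)))))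
          where
          e : Enumeration (class x) (suc k)
          e = ofSize⇒enumeration k (ofSize-∼ k (∼-sym x∼y) (A⊂k y∈A))
          f : Fin (suc m) → J
          f = points (h x∈)
          f∼ : ∀ i → x ∼ f i
          f∼ i = proj₁ (inside (h x∈) i)
          index : Fin (suc m) → Fin (suc k)
          index i = proj₁ (Enumeration.complete e (f∼ i))
          index-point : ∀ i → Enumeration.point e (index i) ≡ f i
          index-point i = proj₂ (Enumeration.complete e (f∼ i))
          index-inj : Injective _≡_ _≡_ index
          index-inj {i} {j} eq = distinct (h x∈)
            (trans (sym (index-point i)) (trans (cong (Enumeration.point e) eq) (index-point j)))
        lower : ratio ⊙ prob (sat A) ⊑ prob A
        lower = ⊑-trans x⊑x+y (⊑-trans (≋⇒⊒ (E-simple-∷ t []))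
          (⊑-trans (E-upper (λ x → μ partition x (set A)) (t ∷ []) bound)
          (⊑-trans (≋⇒⊑ (≈⇒≋ (re-randomizing (set A) (measurable A)))) (≋⇒⊒ (prob≋π {A})))))

      -- A re-randomized point lands in `A` with probability at most 1/(k + 1) when its class meets
      -- `A`, which then contains a single point of `A`, and with probability 0 otherwise.
      ofSize-prob-upper : ∀ k {A} → A ⊂ ofSize k →
        (∀ {x y} → x ∈ A → y ∈ A → x ∼ y → x ≡ y) → prob A ⊑ 1/suc k ⊙ prob (sat A)
      ofSize-prob-upper k {A} A⊂k unique = ⊑-trans (≋⇒⊑ (prob≋π {A}))
        (⊑-trans (≋⇒⊒ (≈⇒≋ (re-randomizing (set A) (measurable A))))
          (E-⊑-· (λ x → μ partition x (set A)) (sat A) (0≤1/suc k) on-sat off-sat))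
        where
        on-sat : ∀ {x} → x ∈ sat A → μ partition x (set A) ⊑ fromℚ (1/suc k)
        on-sat {x} (y , x∼y , y∈A) = ⨆-lub (μ-family x A) λ
          { (inj₁ (m , e)) → ⊑-trans (≋⇒⊒ (μ-finite A e)) (bound (ofSize-unique k m x∈k (enumeration⇒ofSize m e)) e)
          ; (inj₂ ¬fin) → contradiction (k , ofSize⇒enumeration k x∈k) ¬fin }
          where
          x∈k : x ∈ ofSize k
          x∈k = ofSize-∼ k (∼-sym x∼y) (A⊂k y∈A)
          bound : ∀ {m} → k ≡ m → (e : Enumeration (class x) (suc m)) → average A e ⊑ fromℚ (1/suc k)
          bound refl e = ·⊑fromℚ (0≤1/suc k) (count-unique em {A = set A} point λ {i} {j} p q →
              injective (unique p q (∼-trans (∼-sym (sound i)) (sound j))))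
            where open Enumeration e
        off-sat : ∀ {x} → x ∉ sat A → μ partition x (set A) ⊑ fromℚ 0ℚ
        off-sat {x} x∉ = ⨆-lub (μ-family x A) λ
          { (inj₁ (m , e)) → ⊑-trans (≋⇒⊒ (μ-finite A e)) (0⊑fromℚ (⊑-trans (·-mono
              (count-none {A = set A} (Enumeration.point e) λ i p → x∉ (Enumeration.point e i , Enumeration.sound e i , p)))
              (r·0⊑0 (0≤1/suc m))))
          ; (inj₂ _) → 0⊑fromℚ (𝟙-∉ {b = ℓ} {A = set A} λ x∈A → x∉ (∈-sat {A = A} x∈A)) }

      -- `I (sat A)` counts the finite classes meeting `A`, and each of them uses up `m + 1` points
      -- of `A`. The case `m = 0` is `I-sat⊑prob`; larger `m` serves when `A` is a union of classes
      -- of size `m + 1` of a finer partition.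
      I-sat-lower : ∀ m A → (∀ {x} → x ∈ sat A → x ∈ finite → Contains (λ y → x ∼ y × y ∈ A) (suc m)) →
                    I (sat A) ⊑ 1/suc m ⊙ prob A
      I-sat-lower m A h = ⊑-trans (∑-mono λ k → ⊑-trans
          (·-mono (prob-mono λ ((y , x∼y , y∈A) , p) → y , x∼y , y∈A , ofSize-∼ k x∼y p))
          (ofSize-prob-lower k m {A ∩ ofSize k} proj₂ λ { {x} (y , x∼y , y∈A , p) →
            contains-⊆ (λ (x∼z , z∈A) → x∼z , z∈A , ofSize-∼ k (∼-trans (∼-sym x∼y) x∼z) p)
              (h (y , x∼y , y∈A) (k , ofSize-∼ k (∼-sym x∼y) p)) }))
        (⊑-trans (∑-·-⊒ (0≤1/suc m)) (·-mono (prob-disjoint (λ k → A ∩ ofSize k)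
          (λ i j i≢j (_ , p) (_ , q) → i≢j (ofSize-unique i j p q)) λ _ → proj₁)))

      I-sat⊑prob : ∀ A → I (sat A) ⊑ prob A
      I-sat⊑prob A = ⊑-trans (I-sat-lower 0 A λ (y , x∼y , y∈A) _ →
          contains (λ _ → y) (λ { {zero} {zero} _ → refl }) λ _ → x∼y , y∈A)
        (subst (λ r → r ⊙ prob A ⊑ prob A) (sym 1/suc-zero) (≋⇒⊑ 1·x≋x))

      prob⊑I-sat : ∀ A → A ⊂ finite → (∀ {x y} → x ∈ A → y ∈ A → x ∼ y → x ≡ y) → prob A ⊑ I (sat A)
      prob⊑I-sat A A⊂fin unique = ⊑-trans
        (prob-subadditive (λ k → A ∩ ofSize k) λ p → let k , q = A⊂fin p in k , p , q)
        (∑-mono λ k → ⊑-trans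
          (ofSize-prob-upper k {A ∩ ofSize k} proj₂ λ (p , _) (q , _) → unique p q)
          (·-mono (prob-mono λ (y , x∼y , y∈A , p) → (y , x∼y , y∈A) , ofSize-∼ k (∼-sym x∼y) p)))


  -- Measurable selection

  -- Finiteness without a count: the list may have repetitions and points outside `B`, so that
  -- finite unions are plain concatenations.
  record Covered (B : Pred J ℓ) : Set ℓ where
    constructor covered
    field
      list   : List J
      covers : ∀ {x} → B x → x ∈ˡ list

  open Covered

  covered-⊆ : ∀ {A B : Pred J ℓ} → (∀ {x} → A x → B x) → Covered B → Covered A
  covered-⊆ h (covered xs f) = covered xs (f ∘ h)

  enumeration⇒covered : ∀ {B : Pred J ℓ} {n} → Enumeration B n → Covered B
  enumeration⇒covered {B} e = covered (List.tabulate point) λ x∈B → member (complete x∈B)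
    where
    open Enumeration e
    member : ∀ {x} → (∃ λ k → point k ≡ x) → x ∈ˡ List.tabulate point
    member (k , refl) = ∈-tabulate⁺ k

  module Select (P : BPartition measurableSpace) where

    open Class P public

    -- In each class, keep only the part in U n whenever that leaves something.
    stage : Event → ℕ → Event
    stage A zero    = A
    stage A (suc n) = (stage A n ∩ U n) ∪ (stage A n ∖ sat (stage A n ∩ U n))

    -- Every stage meets all the classes that `A` meets, but the intersection may lose a class in
    -- which `A` has infinitely many points.
    select : Event → Event
    select A = ⋂ (stage A)

    stage-suc : ∀ A n → stage A (suc n) ⊂ stage A n
    stage-suc A n = [ proj₁ , proj₁ ]

    stage-mono : ∀ A {m n} → m ℕ.≤ n → stage A n ⊂ stage A m
    stage-mono A {m} m≤n = go (ℕ.≤⇒≤′ m≤n)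
      where
      go : ∀ {n} → m ℕ.≤′ n → stage A n ⊂ stage A m
      go ℕ.≤′-refl            p = p
      go (ℕ.≤′-step {n} m≤′n) p = go m≤′n (stage-suc A n p)

    stage⊂ : ∀ A n → stage A n ⊂ A
    stage⊂ A n = stage-mono A {0} {n} ℕ.z≤n

    select⊂ : ∀ A → select A ⊂ A
    select⊂ A p = p 0

    stage-meets : ∀ A n {x} → x ∈ sat A → x ∈ sat (stage A n)
    stage-meets A zero    p = p
    stage-meets A (suc n) p with stage-meets A n p
    ... | y , x∼y , y∈ with y ∈? sat (stage A n ∩ U n)
    ... | yes (z , y∼z , z∈) = z , ∼-trans x∼y y∼z , inj₁ z∈
    ... | no y∉ = y , x∼y , inj₂ (y∈ , y∉)

    -- If some `U k` contained `x` but not `y`, then `x` would witness that stage `k` of this class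
    -- meets `U k`, and `y` would be discarded in the next stage.
    select-unique : ∀ A {x y} → x ∈ select A → y ∈ select A → x ∼ y → x ≡ y
    select-unique A {x} {y} p q x∼y = stable λ x≢y →
      let k , x∈U , y∉U = U-separates₁ x≢y in
      [ (λ (_ , y∈U) → y∉U y∈U)
      , (λ (_ , y∉sat) → y∉sat (x , ∼-sym x∼y , p k , x∈U)) ] (q (suc k))

    -- If each of the finitely many candidates were discarded at some stage, the latest of these
    -- stages would miss the class, against `stage-meets`.
    select-meets : ∀ A {x} → Covered (λ y → x ∼ y × y ∈ A) → x ∈ sat A → x ∈ sat (select A)
    select-meets A {x} (covered xs f) p = stable λ x∉ →
      let n , h = eliminate xs λ {y} x∼y y∈ → x∉ (y , x∼y , y∈)
          y , x∼y , y∈ = stage-meets A n p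
      in h (f (x∼y , stage⊂ A n y∈)) x∼y y∈
      where
      eliminate : ∀ ys → (∀ {y} → x ∼ y → y ∉ select A) → ∃ λ n → ∀ {y} → y ∈ˡ ys → x ∼ y → y ∉ stage A n
      eliminate []       h = 0 , λ ()
      eliminate (y ∷ ys) h with eliminate ys h | em {P = ∃ λ n → y ∉ stage A n}
      ... | n , g | no ∄ = n , λ
        { (here refl) x∼y _ → h x∼y λ m → stable λ y∉ → ∄ (m , y∉)
        ; (there z∈) → g z∈ }
      ... | n , g | yes (m , y∉) = m ℕ.⊔ n , λ
        { (here refl) _ z∈ → y∉ (stage-mono A {m} {m ℕ.⊔ n} (ℕ.m≤m⊔n m n) z∈)
        ; (there z∈ys) x∼z z∈ → g z∈ys x∼z (stage-mono A {n} {m ℕ.⊔ n} (ℕ.m≤n⊔m m n) z∈) }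

    finite⇒covered : ∀ {x} → x ∈ finite → Covered (class x)
    finite⇒covered (k , p) = enumeration⇒covered (ofSize⇒enumeration k p)

    covered-sat : ∀ {B : Pred J ℓ} → (∀ {x} → B x → x ∈ finite) → Covered B →
                  Covered (λ y → ∃ λ z → y ∼ z × B z)
    covered-sat {B} fin (covered xs f) = covered (List.concatMap (λ x → members (x ∈? finite)) xs)
      λ {y} (z , y∼z , z∈B) →
        ∈-concatMap⁺ (λ x → members (x ∈? finite)) (f-any (f z∈B) (∈-members (fin z∈B) (∼-sym y∼z) (z ∈? finite)))
      where
      -- Points of the list outside `B` may have infinite classes; they contribute nothing.
      members : ∀ {x} → Dec (x ∈ finite) → List J
      members (yes p) = list (finite⇒covered p)
      members (no _)  = []
      ∈-members : ∀ {x y} → x ∈ finite → x ∼ y → (d : Dec (x ∈ finite)) → y ∈ˡ members d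
      ∈-members _ x∼y (yes p) = covers (finite⇒covered p) x∼y
      ∈-members p x∼y (no ¬p) = contradiction p ¬p
      f-any : ∀ {y z ys} → z ∈ˡ ys → y ∈ˡ members (z ∈? finite) → Any (λ x → y ∈ˡ members (x ∈? finite)) ys
      f-any z∈ h = Any.map (λ { refl → h }) z∈

    infinite⇒contains : ∀ {x} → x ∈ infinite → ∀ n → Contains (class x) (suc n)
    infinite⇒contains {x} inf zero = contains (λ _ → x) (λ { {zero} {zero} _ → refl }) λ _ → ∼-refl
    infinite⇒contains {x} inf (suc n) = stable λ ¬c →
      inf (n , enumeration⇒ofSize n (maximal⇒enumeration em (infinite⇒contains inf n) ¬c))

    I-mono : ∀ {A B} → A ⊂ B → I A ⊑ I B
    I-mono f = ∑-mono λ k → ·-mono (prob-mono λ (p , q) → f p , q)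


  -- Transversals

  module Transport (C S : BPartition measurableSpace) (re-randomizing : ReRandomizing Ω C)
                   (C⇒S : ∀ {x y} → BPartition._∼_ C x y → BPartition._∼_ S x y) where

    private
      module C = Select C
      module S = Select S

    Transversal : Event → Set ℓ
    Transversal T = ∀ {x y} → x ∈ T → y ∈ T → x S.∼ y → x ≡ y

    -- Transversals inside X are no smaller than the part of Z in the same components;
    -- this passes from X to C.sat X, hence spreads from Z through its components.
    Dominated : Event → Event → Set (lsuc ℓ)
    Dominated Z X = ∀ T → T ⊂ X → Transversal T → prob (Z ∩ S.sat T) ⊑ prob T

    -- `T` is pulled back into `X` along the classes of `C`: `T′` has one point of `X` in each of
    -- the classes that `T` meets, so it reaches the same components. The measure does not grow,
    -- because `prob T′` is at most the number of finite classes meeting `T′`, measured by `I`, and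
    -- each of them meets `T`.
    dominated-sat : ∀ Z X → X ⊂ C.finite → Dominated Z X → Dominated Z (C.sat X)
    dominated-sat Z X X⊂fin dom T T⊂ trans-T =
      ⊑-trans (prob-mono λ (p , q) → p , sat-T q)
      (⊑-trans (dom T′ (λ p → proj₁ (T′⊂ p)) trans-T′)
      (⊑-trans (C.prob⊑I-sat re-randomizing T′ (λ p → X⊂fin (proj₁ (T′⊂ p))) (C.select-unique (X ∩ C.sat T)))
      (⊑-trans (C.I-mono (C.sat-sat {T′} {T} λ p → proj₂ (T′⊂ p)))
               (C.I-sat⊑prob re-randomizing T))))
      where
      T′ : Event
      T′ = C.select (X ∩ C.sat T)
      T′⊂ : T′ ⊂ X ∩ C.sat T
      T′⊂ = C.select⊂ (X ∩ C.sat T)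
      T⊂sat-T′ : T ⊂ C.sat T′
      T⊂sat-T′ {x} x∈T with T⊂ x∈T
      ... | y , x∼y , y∈X = C.select-meets (X ∩ C.sat T)
        (covered-⊆ proj₁ (C.finite⇒covered (C.finite-∼ (C.∼-sym x∼y) (X⊂fin y∈X))))
        (y , x∼y , y∈X , x , C.∼-sym x∼y , x∈T)
      sat-T : S.sat T ⊂ S.sat T′
      sat-T (y , x∼y , y∈T) = let z , y∼z , z∈ = T⊂sat-T′ y∈T in z , S.∼-trans x∼y (C⇒S y∼z) , z∈
      trans-T′ : Transversal T′
      trans-T′ x∈ y∈ x∼y with proj₂ (T′⊂ x∈) | proj₂ (T′⊂ y∈)
      ... | u , x∼u , u∈T | v , y∼v , v∈T
        with refl ← trans-T u∈T v∈T (S.∼-trans (S.∼-sym (C⇒S x∼u)) (S.∼-trans x∼y (C⇒S y∼v)))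
        = C.select-unique (X ∩ C.sat T) x∈ y∈ (C.∼-trans x∼u (C.∼-sym y∼v))

  -- Counting classes by classes of a refinement

  module Refined (C R : BPartition measurableSpace) (re-randomizing : ReRandomizing Ω C)
                 (R⇒C : ∀ {x y} → BPartition._∼_ R x y → BPartition._∼_ C x y) where

    private
      module C = Select C
      module R = Select R

    finite⇒finite : C.finite ⊂ R.finite
    finite⇒finite {x} (k , p) = stable λ x∈inf → ℕ.<-irrefl refl
      (contains⇒≤ (C.ofSize⇒enumeration k p) (contains-⊆ R⇒C (R.infinite⇒contains x∈inf (suc k))))

    -- A finite class of `C` is paid for by a point of `D` or by a whole `R`-class in `T`. In the
    -- second case, with `R`-classes of size `r + 1`, it contains at least `r + 1` points of
    -- `T ∩ R.ofSize r`, and `I-sat-lower` yields exactly the weight of that size in `R.I T`.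
    I-sat⊑I : ∀ D T → (∀ {x y} → x R.∼ y → x ∈ T → y ∈ T) →
              (∀ {x} → x ∈ C.finite → x ∈ C.sat D ⊎ x ∈ C.sat T) → C.I Ω₀ ⊑ prob D ⊕ R.I T
    I-sat⊑I D T T-∼ h = ⊑-trans
      (C.I-subadditive family λ _ fin → covering fin (h fin))
      (⊑-trans ∑-head (+-mono (C.I-sat⊑prob re-randomizing D)
        (∑-mono λ r → C.I-sat-lower re-randomizing r (T ∩ R.ofSize r) λ (y , x∼y , y∈T , q) _ →
          contains-⊆ (λ y∼z → C.∼-trans x∼y (R⇒C y∼z) , T-∼ y∼z y∈T , R.ofSize-∼ r y∼z q)
            (enumeration⇒contains (R.ofSize⇒enumeration r q)))))
      where
      family : ℕ → Event
      family = C.sat D ,, λ r → C.sat (T ∩ R.ofSize r)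
      covering : ∀ {x} → x ∈ C.finite → x ∈ C.sat D ⊎ x ∈ C.sat T → ∃ λ n → x ∈ family n
      covering fin (inj₁ p) = 0 , p
      covering fin (inj₂ (y , x∼y , y∈T)) =
        let r , q = finite⇒finite (C.finite-∼ x∼y fin) in suc r , y , x∼y , y∈T , q

  module _ (P Q : BPartition measurableSpace) (rP : ReRandomizing Ω P) (rQ : ReRandomizing Ω Q) where

    private
      module P = Select P
      module Q = Select Q
      module S = Select (P ∨ Q)

    P⇒S : ∀ {x y} → x P.∼ y → x S.∼ y
    P⇒S p = Eq.return (inj₁ p)

    Q⇒S : ∀ {x y} → x Q.∼ y → x S.∼ y
    Q⇒S q = Eq.return (inj₂ q)

    S-induction : ∀ {b} (B : Pred J b) → (∀ {x y} → x P.∼ y → B x → B y) → (∀ {x y} → x Q.∼ y → B x → B y) →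
                  ∀ {x y} → x S.∼ y → B x → B y
    S-induction B f g ε b = b
    S-induction B f g (fwd (inj₁ p) ◅ s) b = S-induction B f g s (f p b)
    S-induction B f g (fwd (inj₂ q) ◅ s) b = S-induction B f g s (g q b)
    S-induction B f g (bwd (inj₁ p) ◅ s) b = S-induction B f g s (f (P.∼-sym p) b)
    S-induction B f g (bwd (inj₂ q) ◅ s) b = S-induction B f g s (g (Q.∼-sym q) b)

    open Transport P (P ∨ Q) rP P⇒S using (Transversal; Dominated)

    -- The union of the components in which all classes of 𝒫 and 𝒬 are finite; the components
    -- themselves may be infinite.
    locallyFinite : Event
    locallyFinite = ∁ (S.sat (P.infinite ∪ Q.infinite))

    locallyFinite-∼ : ∀ {x y} → x S.∼ y → x ∈ locallyFinite → y ∈ locallyFinite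
    locallyFinite-∼ x∼y x∈ y∈ = x∈ (S.sat-∼ {A = P.infinite ∪ Q.infinite} (S.∼-sym x∼y) y∈)

    locallyFinite⇒P-finite : locallyFinite ⊂ P.finite
    locallyFinite⇒P-finite {x} x∈ = stable λ p → x∈ (x , S.∼-refl , inj₁ p)

    locallyFinite⇒Q-finite : locallyFinite ⊂ Q.finite
    locallyFinite⇒Q-finite {x} x∈ = stable λ p → x∈ (x , S.∼-refl , inj₂ p)

    module Grow (Z : Event) (Z⊂F : Z ⊂ locallyFinite) (Z-trans : Transversal Z) where

      -- `X` consists of `k + 1` disjoint layers, the lowest being `Z`. Each layer has one point in
      -- every component that `Z` meets and at least the measure of `Z`. The field `dominated` is
      -- what makes the next layer large enough.
      record Stack (k : ℕ) : Set (lsuc ℓ) where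
        field
          X         : Event
          Z⊂X       : Z ⊂ X
          X⊂        : X ⊂ S.sat Z
          fibre     : ∀ {z} → z ∈ Z → Enumeration (λ y → z S.∼ y × y ∈ X) (suc k)
          dominated : Dominated Z X
          size      : fromℕ (suc k) ⊙ prob Z ⊑ prob X

      sat-Z⊂F : S.sat Z ⊂ locallyFinite
      sat-Z⊂F (z , x∼z , z∈Z) = locallyFinite-∼ (S.∼-sym x∼z) (Z⊂F z∈Z)

      base : Stack 0
      base = record
        { X = Z
        ; Z⊂X = λ p → p
        ; X⊂ = S.∈-sat {A = Z}
        ; fibre = λ {z} z∈ → record
          { point = λ _ → z
          ; injective = λ { {zero} {zero} _ → refl }
          ; sound = λ _ → S.∼-refl , z∈
          ; complete = λ (z∼y , y∈) → zero , Z-trans z∈ y∈ z∼y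
          }
        ; dominated = λ T T⊂Z _ → prob-mono λ { (x∈Z , y , x∼y , y∈T) →
            subst (_∈ T) (sym (Z-trans x∈Z (T⊂Z y∈T) x∼y)) y∈T }
        ; size = subst (λ r → r ⊙ prob Z ⊑ prob Z) (sym fromℕ-one) (≋⇒⊑ 1·x≋x)
        }

      module Step {k} (stack : Stack k) (large : ∀ {z} → z ∈ Z → Contains (S.class z) (suc (suc k))) where
        open Stack stack

        -- `W` is the next layer. Taking it from the neighbourhood `N` of `X`, rather than from the
        -- whole component, leaves finitely many candidates even in infinite components, so that the
        -- selection loses none, and `N` is within reach of `dominated-sat`.
        N W : Event
        N = Q.sat (P.sat X)
        W = S.select (N ∖ X)

        X⊂N : X ⊂ N
        X⊂N p = Q.∈-sat {A = P.sat X} (P.∈-sat {A = X} p)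

        P-sat⊂ : P.sat X ⊂ S.sat Z
        P-sat⊂ (y , x∼y , y∈) = S.sat-∼ {A = Z} (S.∼-sym (P⇒S x∼y)) (X⊂ y∈)

        N⊂ : N ⊂ S.sat Z
        N⊂ (y , x∼y , y∈) = S.sat-∼ {A = Z} (S.∼-sym (Q⇒S x∼y)) (P-sat⊂ y∈)

        W⊂ : W ⊂ N ∖ X
        W⊂ = S.select⊂ (N ∖ X)

        fibre-covered : ∀ {z} → z ∈ Z → Covered (λ y → z S.∼ y × y ∈ N)
        fibre-covered {z} z∈ = covered-⊆
          (λ (z∼y , w , y∼w , v , w∼v , v∈) →
            w , y∼w , v , w∼v , S.∼-trans z∼y (S.∼-trans (Q⇒S y∼w) (P⇒S w∼v)) , v∈)
          (Q.covered-sat (λ { (v , w∼v , z∼v , _) →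
              locallyFinite⇒Q-finite (locallyFinite-∼ (S.∼-trans z∼v (S.∼-sym (P⇒S w∼v))) (Z⊂F z∈)) })
            (P.covered-sat (λ (z∼v , _) → locallyFinite⇒P-finite (locallyFinite-∼ z∼v (Z⊂F z∈)))
              (enumeration⇒covered (fibre z∈))))

        -- Otherwise X would contain the class of z, which has too many elements.
        meets-N∖X : ∀ {z} → z ∈ Z → z ∈ S.sat (N ∖ X)
        meets-N∖X {z} z∈ = stable λ z∉ → ℕ.<-irrefl refl (contains⇒≤ (fibre z∈)
          (contains-⊆ (λ z∼y → z∼y , proj₂ (S-induction (λ y → z S.∼ y × y ∈ X)
              (λ p (z∼x , x∈) → S.∼-trans z∼x (P⇒S p) ,
                stay z∉ (S.∼-trans z∼x (P⇒S p)) (Q.∈-sat {A = P.sat X} (_ , P.∼-sym p , x∈)))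
              (λ q (z∼x , x∈) → S.∼-trans z∼x (Q⇒S q) ,
                stay z∉ (S.∼-trans z∼x (Q⇒S q)) (_ , Q.∼-sym q , P.∈-sat {A = X} x∈))
              z∼y (S.∼-refl , Z⊂X z∈)))
            (large z∈)))
          where
          stay : z ∉ S.sat (N ∖ X) → ∀ {y} → z S.∼ y → y ∈ N → y ∈ X
          stay z∉ z∼y y∈N = stable λ y∉X → z∉ (_ , z∼y , y∈N , y∉X)

        meets-W : Z ⊂ S.sat W
        meets-W z∈ = S.select-meets (N ∖ X)
          (covered-⊆ (λ (z∼y , y∈N , _) → z∼y , y∈N) (fibre-covered z∈)) (meets-N∖X z∈)

        dominated-N : Dominated Z N
        dominated-N = Transport.dominated-sat Q (P ∨ Q) rQ Q⇒S Z (P.sat X) (λ p → locallyFinite⇒Q-finite (sat-Z⊂F (P-sat⊂ p)))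
          (Transport.dominated-sat P (P ∨ Q) rP P⇒S Z X (λ p → locallyFinite⇒P-finite (sat-Z⊂F (X⊂ p))) dominated)

        prob-W : prob Z ⊑ prob W
        prob-W = ⊑-trans (prob-mono λ z∈ → z∈ , meets-W z∈)
          (dominated-N W (λ p → proj₁ (W⊂ p)) (S.select-unique (N ∖ X)))

        next : Stack (suc k)
        next = record
          { X = X ∪ W
          ; Z⊂X = λ p → inj₁ (Z⊂X p)
          ; X⊂ = [ X⊂ , (λ p → N⊂ (proj₁ (W⊂ p))) ]
          ; fibre = next-fibre
          ; dominated = λ T T⊂ → dominated-N T λ p → [ X⊂N , (λ q → proj₁ (W⊂ q)) ] (T⊂ p)
          ; size = ⊑-trans (subst (λ r → r ⊙ prob Z ⊑ (1ℚ ℚ.+ fromℕ (suc k)) ⊙ prob Z) (sym (fromℕ-suc (suc k))) ⊑-refl)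
              (⊑-trans (·-distribʳ-⊑ (ℚ.positive⁻¹ 1ℚ) (0<fromℕ k))
              (⊑-trans (+-mono (⊑-trans (≋⇒⊑ 1·x≋x) prob-W) size)
              (⊑-trans +-comm-⊑ (≋⇒⊒ (prob-∪ X W λ p q → proj₂ (W⊂ q) p)))))
          }
          where
          module _ {z} (z∈ : z ∈ Z) where
            open Enumeration (fibre z∈)
            w : J
            w = proj₁ (meets-W z∈)
            z∼w : z S.∼ w
            z∼w = proj₁ (proj₂ (meets-W z∈))
            w∈ : w ∈ W
            w∈ = proj₂ (proj₂ (meets-W z∈))
            enlarged : Contains (λ y → z S.∼ y × y ∈ X ∪ W) (suc (suc k))
            enlarged = contains-cons (z∼w , inj₂ w∈)
              (contains point injective λ i → proj₁ (sound i) , inj₁ (proj₂ (sound i)))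
              λ i eq → proj₂ (W⊂ w∈) (subst (_∈ X) eq (proj₂ (sound i)))
            enlarged-complete : ∀ {y} → z S.∼ y × y ∈ X ∪ W → ∃ λ i → points enlarged i ≡ y
            enlarged-complete (z∼y , inj₁ y∈X) = let i , eq = complete (z∼y , y∈X) in suc i , eq
            enlarged-complete (z∼y , inj₂ y∈W) = zero ,
              S.select-unique (N ∖ X) w∈ y∈W (S.∼-trans (S.∼-sym z∼w) z∼y)
            next-fibre : Enumeration (λ y → z S.∼ y × y ∈ X ∪ W) (suc (suc k))
            next-fibre = record
              { point = points enlarged ; injective = distinct enlarged ; sound = inside enlarged ; complete = enlarged-complete }

      stack : ∀ k → (∀ {z} → z ∈ Z → Contains (S.class z) (suc k)) → Stack k
      stack zero    large = base
      stack (suc k) large = Step.next (stack k λ p → contains-tail (large p)) large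

      prob-transversal : ∀ k → (∀ {z} → z ∈ Z → Contains (S.class z) (suc k)) →
                         fromℕ (suc k) ⊙ prob Z ⊑ prob (S.sat Z)
      prob-transversal k large = ⊑-trans (Stack.size s) (prob-mono (Stack.X⊂ s))
        where
        s : Stack k
        s = stack k large

    -- On components of size `k + 1` a stack of `k + 1` layers fits into `S.ofSize k`, so `Z` has at
    -- most 1/(k + 1) of that measure. On infinite components stacks of every height exist, and `Z`
    -- is null.
    prob-transversal⊑I : ∀ Z → Z ⊂ locallyFinite → Transversal Z → prob Z ⊑ S.I Ω₀
    prob-transversal⊑I Z Z⊂F Z-trans = ⊑-trans (≋⇒⊑ (prob-split Z S.finite))
      (⊑-trans (+-mono finite-part infinite-part) (x+y⊑x ⊑-refl))
      where
      infinite-part : prob (Z ∖ S.finite) ⊑ 𝟘 {0ℓ}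
      infinite-part = bounded-multiples⇒0 λ n → ⊑-trans
        (Grow.prob-transversal (Z ∖ S.finite) (λ (p , _) → Z⊂F p) (λ (p , _) (q , _) → Z-trans p q) n
          λ (_ , p) → S.infinite⇒contains p n)
        prob⊑1
      finite-part : prob (Z ∩ S.finite) ⊑ S.I Ω₀
      finite-part = ⊑-trans (prob-subadditive (λ k → Z ∩ S.ofSize k) λ (p , k , q) → k , p , q)
        (∑-mono λ k → ·-cancel k (⊑-trans
          (Grow.prob-transversal (Z ∩ S.ofSize k) (λ (p , _) → Z⊂F p) (λ (p , _) (q , _) → Z-trans p q) k
            λ (_ , p) → enumeration⇒contains (S.ofSize⇒enumeration k p))
          (prob-mono λ (y , x∼y , _ , p) → _ , S.ofSize-∼ k (S.∼-sym x∼y) p)))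

    -- Counting edges

    module Forest (R : BPartition measurableSpace) (R≼P : R ≼ P) (R≼Q : R ≼ Q)
                  (B : Event) (B-meets : locallyFinite ⊂ S.sat B) where

      private
        module R = Select R

      ≼⇒⊆ : ∀ C → R ≼ C → ∀ {x y} → x R.∼ y → BPartition._∼_ C x y
      ≼⇒⊆ C R≼C {x} x∼y = let z , f = R≼C x in
        BPartition.∼-trans C (BPartition.∼-sym C (f R.∼-refl)) (f x∼y)

      R⇒P : ∀ {x y} → x R.∼ y → x P.∼ y
      R⇒P = ≼⇒⊆ P R≼P

      R⇒Q : ∀ {x y} → x R.∼ y → x Q.∼ y
      R⇒Q = ≼⇒⊆ Q R≼Q

      -- Breadth-first search from the roots. `B` starts it on the 𝒫 side only, so that `prob B` is
      -- paid once.
      reachedP reachedQ : ℕ → Event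
      reachedP zero    = P.sat B ∪ P.infinite
      reachedP (suc n) = reachedP n ∪ P.sat (reachedQ n)
      reachedQ zero    = Q.infinite
      reachedQ (suc n) = reachedQ n ∪ Q.sat (reachedP n)

      reachedP-∼ : ∀ n {x y} → x P.∼ y → x ∈ reachedP n → y ∈ reachedP n
      reachedP-∼ zero    x∼y (inj₁ p) = inj₁ (P.sat-∼ {A = B} x∼y p)
      reachedP-∼ zero    x∼y (inj₂ p) = inj₂ λ q → p (P.finite-∼ (P.∼-sym x∼y) q)
      reachedP-∼ (suc n) x∼y (inj₁ p) = inj₁ (reachedP-∼ n x∼y p)
      reachedP-∼ (suc n) x∼y (inj₂ p) = inj₂ (P.sat-∼ {A = reachedQ n} x∼y p)

      reachedQ-∼ : ∀ n {x y} → x Q.∼ y → x ∈ reachedQ n → y ∈ reachedQ n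
      reachedQ-∼ zero    x∼y p        = λ q → p (Q.finite-∼ (Q.∼-sym x∼y) q)
      reachedQ-∼ (suc n) x∼y (inj₁ p) = inj₁ (reachedQ-∼ n x∼y p)
      reachedQ-∼ (suc n) x∼y (inj₂ p) = inj₂ (Q.sat-∼ {A = reachedP n} x∼y p)

      reached-mono : ∀ {m n} → m ℕ.≤′ n → reachedP m ⊂ reachedP n × reachedQ m ⊂ reachedQ n
      reached-mono ℕ.≤′-refl        = (λ p → p) , (λ p → p)
      reached-mono (ℕ.≤′-step m≤′n) = let f , g = reached-mono m≤′n in (λ p → inj₁ (f p)) , (λ p → inj₁ (g p))

      reached-∼ : ∀ {x y} → x S.∼ y → x ∈ ⋃ reachedP → y ∈ ⋃ reachedP
      reached-∼ = S-induction (_∈ ⋃ reachedP)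
        (λ x∼y (n , p) → n , reachedP-∼ n x∼y p)
        -- Two rounds: the 𝒬-class of `x` is reached in the first, and the 𝒫-class of `y` through it
        -- in the second.
        (λ {x} x∼y (n , p) → suc (suc n) , inj₂ (P.∈-sat {A = reachedQ (suc n)} (inj₂ (x , Q.∼-sym x∼y , p))))

      all-reached : ∀ x → x ∈ ⋃ reachedP
      all-reached x = decide (x ∈? locallyFinite)
        where
        start : ∀ {y} → y ∈ P.infinite ∪ Q.infinite → y ∈ ⋃ reachedP
        start (inj₁ p) = 0 , inj₂ p
        start (inj₂ q) = 1 , inj₂ (P.∈-sat {A = Q.infinite} q)
        decide : Dec (x ∈ locallyFinite) → x ∈ ⋃ reachedP
        decide (yes x∈F) = let b , x∼b , b∈B = B-meets x∈F in
          reached-∼ (S.∼-sym x∼b) (0 , inj₁ (P.∈-sat {A = B} b∈B))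
        decide (no x∉F) = let y , x∼y , y∈ = stable x∉F in reached-∼ (S.∼-sym x∼y) (start y∈)

      -- As reachedP n and reachedQ n collect the vertices at distance about n from the
      -- roots, T₁ (T₂) consists of the edges leading from a 𝒫-class (𝒬-class) towards
      -- the roots.
      T₁ T₂ : Event
      T₁ = ⋃ λ n → reachedQ n ∖ reachedP n
      T₂ = ⋃ λ n → reachedP n ∖ reachedQ n

      T-disjoint : ∀ {x} → x ∈ T₁ → x ∉ T₂
      T-disjoint (m , p , ¬q) (n , q , ¬p) =
        [ (λ m≤n → ¬p (proj₂ (reached-mono (ℕ.≤⇒≤′ m≤n)) p))
        , (λ n≤m → ¬q (proj₁ (reached-mono (ℕ.≤⇒≤′ n≤m)) q)) ] (ℕ.≤-total m n)

      T₁-∼ : ∀ {x y} → x R.∼ y → x ∈ T₁ → y ∈ T₁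
      T₁-∼ x∼y (n , p , ¬q) = n , reachedQ-∼ n (R⇒Q x∼y) p , λ q → ¬q (reachedP-∼ n (P.∼-sym (R⇒P x∼y)) q)

      T₂-∼ : ∀ {x y} → x R.∼ y → x ∈ T₂ → y ∈ T₂
      T₂-∼ x∼y (n , p , ¬q) = n , reachedP-∼ n (R⇒P x∼y) p , λ q → ¬q (reachedQ-∼ n (Q.∼-sym (R⇒Q x∼y)) q)

      -- Descent to the round in which the class is first reached: the edge at `y` that reached it
      -- has its 𝒬-end in `reachedQ n` and its 𝒫-end not yet in `reachedP n`, hence lies in `T₁`.
      P-parent : ∀ n {x} → x ∈ reachedP n → x ∈ P.finite → x ∈ P.sat B ⊎ x ∈ P.sat T₁
      P-parent zero    (inj₁ p) _ = inj₁ p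
      P-parent zero    (inj₂ p) x∈fin = contradiction x∈fin p
      P-parent (suc n) (inj₁ p) x∈fin = P-parent n p x∈fin
      P-parent (suc n) (inj₂ (y , x∼y , y∈)) x∈fin with y ∈? reachedP n
      ... | yes p = P-parent n (reachedP-∼ n (P.∼-sym x∼y) p) x∈fin
      ... | no ¬p = inj₂ (y , x∼y , n , y∈ , ¬p)

      Q-parent : ∀ n {x} → x ∈ reachedQ n → x ∈ Q.finite → x ∈ Q.sat T₂
      Q-parent zero    p x∈fin = contradiction x∈fin p
      Q-parent (suc n) (inj₁ p) x∈fin = Q-parent n p x∈fin
      Q-parent (suc n) (inj₂ (y , x∼y , y∈)) x∈fin with y ∈? reachedQ n
      ... | yes p = Q-parent n (reachedQ-∼ n (Q.∼-sym x∼y) p) x∈fin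
      ... | no ¬p = y , x∼y , n , y∈ , ¬p

      I+I⊑I+prob : P.I Ω₀ ⊕ Q.I Ω₀ ⊑ R.I Ω₀ ⊕ prob B
      I+I⊑I+prob = ⊑-trans
        (+-mono
          (Refined.I-sat⊑I P R rP R⇒P B T₁ T₁-∼ λ {x} fin → P-parent (proj₁ (all-reached x)) (proj₂ (all-reached x)) fin)
          -- All roots on the 𝒬 side are infinite classes, so the finite ones all have a parent and
          -- `∅` suffices for `D`. Such a class is reached at most one round after the 𝒫-class of
          -- its point `x`, whence the `suc`.
          (⊑-trans (Refined.I-sat⊑I Q R rQ R⇒Q ∅ T₂ T₂-∼ λ {x} fin →
              inj₂ (Q-parent (suc (proj₁ (all-reached x))) (inj₂ (Q.∈-sat {A = reachedP (proj₁ (all-reached x))} (proj₂ (all-reached x)))) fin))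
            (⊑-trans (+-monoˡ prob-∅) 0+x⊑x)))
        (⊑-trans +-assoc-⊑ (⊑-trans +-comm-⊑ (+-monoˡ
          (R.I-⊕ T₁ T₂ T-disjoint _ _))))

    -- Passage to the limit over the stages of the selection

    module _ (R : BPartition measurableSpace) (R≼P : R ≼ P) (R≼Q : R ≼ Q) where

      private
        module R = Select R

      -- The forest estimate holds with `prob (S.stage F n)` for every `n`; in the limit this
      -- becomes `prob Z`, which `prob-transversal⊑I` bounds by the number of components.
      I+I⊑I+I : P.I Ω₀ ⊕ Q.I Ω₀ ⊑ R.I Ω₀ ⊕ S.I Ω₀
      I+I⊑I+I = ⊑-trans (+-cancelʳ em prob⊑1 enlarged)
        (+-monoʳ (prob-transversal⊑I Z (S.select⊂ F) (S.select-unique F)))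
        where
        F Z : Event
        F = locallyFinite
        Z = S.select F
        L M : ℝ⁺∞ 0ℓ
        L = P.I Ω₀ ⊕ Q.I Ω₀
        M = R.I Ω₀
        -- The stage and `Z` both lie in `F`, so each makes up `prob F` with its complement in `F`;
        -- this trades one for the other without subtraction.
        step : ∀ n → L ⊕ prob (F ∖ S.stage F n) ⊑ (M ⊕ prob Z) ⊕ prob (F ∖ Z)
        step n = ⊑-trans (+-monoˡ (Forest.I+I⊑I+prob R R≼P R≼Q (S.stage F n)
            (λ x∈F → S.stage-meets F n (S.∈-sat {A = F} x∈F))))
          (⊑-trans +-assoc-⊑
          (⊑-trans (+-monoʳ (⊑-trans
            (+-monoˡ (prob-mono {B = F ∩ S.stage F n} λ p → S.stage⊂ F n p , p))
            (⊑-trans (≋⇒⊒ (prob-split F (S.stage F n))) (⊑-trans (≋⇒⊑ (prob-split F Z)) (+-monoˡ (prob-mono proj₂))))))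
          +-assoc-⊒))
        -- Adding prob (F ∖ Z) turns the decrease of the stages to Z into an increasing union.
        enlarged : L ⊕ prob (F ∖ Z) ⊑ (M ⊕ prob Z) ⊕ prob (F ∖ Z)
        enlarged .apply p =
          let r , s , r< , s< , q≤ = ⊕-elim p
              n , s<′ = prob-⋃-elim (λ n → F ∖ S.stage F n) (apply (prob-mono {F ∖ Z} exhaust) s<)
          in apply (step n) (⊕-intro r< (apply (prob-mono (discarded n)) s<′) q≤)
          where
          -- The discarded sets increase with the stage, so the finite union is contained in the one
          -- at `n`.
          discarded : ∀ n → initial (λ n → F ∖ S.stage F n) n ⊂ F ∖ S.stage F n
          discarded n = initial⊂ {λ n → F ∖ S.stage F n} {F ∖ S.stage F n} n λ m m<n (x∈F , x∉) →
            x∈F , λ x∈ → x∉ (S.stage-mono F {m} {n} (ℕ.<⇒≤ m<n) x∈)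
          exhaust : F ∖ Z ⊂ ⋃ (λ n → F ∖ S.stage F n)
          exhaust (x∈F , x∉Z) = stable λ ∄ → x∉Z λ n → stable λ x∉ → ∄ (n , x∈F , x∉)

      ψ+ψ≤ψ+ψ : ψ Ω P + ψ Ω Q ≤ ψ Ω R + ψ Ω (P ∨ Q)
      ψ+ψ≤ψ+ψ (r , s , r< , s< , q≤) =
        let t , u , t< , u< , q≤′ = ⊕-elim (apply I+I⊑I+I (⊕-intro (apply P.ψ⊑I r<) (apply Q.ψ⊑I s<) q≤))
        in t , u , apply R.I⊑ψ t< , apply S.I⊑ψ u< , q≤′

lemma3p1 : (∀ {a} → ExcludedMiddle a) →
    ∀ {ℓ} (Ω : StandardBorelProbabilitySpace ℓ) →
    (P Q R : BPartition (StandardBorelProbabilitySpace.measurableSpace Ω)) →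
    ReRandomizing Ω P → ReRandomizing Ω Q → ReRandomizing Ω R →
    R ≼ P → R ≼ Q →
    ψ Ω P + ψ Ω Q ≤ ψ Ω R + ψ Ω (P ∨ Q)
lemma3p1 em Ω P Q R rP rQ _ R≼P R≼Q = Space.ψ+ψ≤ψ+ψ em Ω P Q rP rQ R R≼P R≼Q
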